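{- Let $S_5=\{(-1,3,1,-3),(-1,4,1,-3),(-1,4,0,-4)\}$. If $(t_1,t_2,t_3,t_4)\in S_5$, then for all integers $n\geq 0$, $$a_{1^{t_1}2^{t_2}3^{t_3}4^{t_4}}(4n)>0,\qquad a_{1^{t_1}2^{t_2}3^{t_3}4^{t_4}}(4n+1)>0,$$ $$a_{1^{t_1}2^{t_2}3^{t_3}4^{t_4}}(4n+2)<0,\qquad a_{1^{t_1}2^{t_2}3^{t_3}4^{t_4}}(4n+3)<0.$$
   Context: For $|q|<1$ (or as formal power series in $q$) let $f_j:=(q^j;q^j)_\infty=\prod_{k\ge 1}(1-q^{jk})$ for each positive integer $j$. For a positive integer $m$ and integers $t_1,\dots,t_m$ (possibly zero or negative), the integers $a_{1^{t_1}2^{t_2}\cdots m^{t_m}}(n)$, $n\ge 0$, are defined by $\sum_{n=0}^\infty a_{1^{t_1}2^{t_2}\cdots m^{t_m}}(n)q^n=f_1^{t_1}f_2^{t_2}\cdots f_m^{t_m}$. -}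

module Defs where

open import Data.Bool.Base using (if_then_else_)
open import Data.Fin.Base using (Fin; zero; suc; toℕ)
open import Data.Fin.Properties using (toℕ<n)
open import Data.Integer.Base using (ℤ; +_; -[1+_]; 0ℤ; 1ℤ; _+_; _-_; _*_; -_)
open import Data.Integer.Properties
  using (+-0-monoid; *-identityˡ; *-zeroˡ; +-inverseˡ; +-identityʳ)
open import Data.List.Base using (List; []; _∷_)
open import Data.Nat.Base as ℕ using (ℕ; zero; suc; _∸_; _≡ᵇ_; NonZero)
import Data.Nat.Properties as ℕ
open import Data.Vec.Base as Vec using (Vec; []; _∷_; lookup; tabulate)
open import Function.Base using (_$_)
open import Relation.Binary.PropositionalEquality
  using (_≡_; refl; sym; trans; cong; cong₂; module ≡-Reasoning)
open import Algebra.Properties.Monoid.Sum +-0-monoid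
  using (sum⁺-syntax; sum-cong-≗; sum-replicate-zero)

infixl 7 _⊛_
infixr 8 _^ℕ_ _^ℤ_

-- Formal power series in q over ℤ; s n is the coefficient of q^n.
Series : Set
Series = ℕ → ℤ

q^ : ℕ → Series
q^ d n = if n ≡ᵇ d then 1ℤ else 0ℤ

one : Series
one = q^ 0

1-q^ : ℕ → Series
1-q^ d n = one n - q^ d n

_⊛_ : Series → Series → Series
(s ⊛ u) n = ∑[ i ≤ n ] (s (toℕ i) * u (n ∸ toℕ i))

_^ℕ_ : Series → ℕ → Series
s ^ℕ zero  = one
s ^ℕ suc k = s ⊛ s ^ℕ k

-- Coefficients n, n-1, …, 0 (in this order) of 1/s, for s with constant term 1.
inverseCoeffs : Series → (n : ℕ) → Vec ℤ (suc n)
inverseCoeffs s zero    = 1ℤ ∷ []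
inverseCoeffs s (suc n) =
  let u = inverseCoeffs s n in
  - (∑[ i ≤ n ] (s (suc (toℕ i)) * lookup u i)) ∷ u

-- Meaningful only when s has constant term 1; see ⊛-inverse and ^ℤ-inverse.
inverse : Series → Series
inverse s n = Vec.head (inverseCoeffs s n)

_^ℤ_ : Series → ℤ → Series
s ^ℤ (+ k)    = s ^ℕ k
s ^ℤ -[1+ k ] = inverse (s ^ℕ suc k)

-- ∏_{k=1}^{K} (1 - q^{jk})
partialProduct : ℕ → ℕ → Series
partialProduct j zero    = one
partialProduct j (suc K) = 1-q^ (j ℕ.* suc K) ⊛ partialProduct j K

-- f_j = ∏_{k≥1} (1 - q^{jk}) for j ≥ 1: the factors with k > n do not affect
-- the coefficient of q^n; see f-limit.
f : ℕ → Series
f j n = partialProduct j n n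

-- a t n is the coefficient of q^n in f_1^{t_1} ⋯ f_m^{t_m}; the position i in t,
-- counted from 0, holds t_{i+1}.
a : ∀ {m} → Vec ℤ m → Series
a t = Vec.foldr′ _⊛_ one (tabulate λ i → f (suc (toℕ i)) ^ℤ lookup t i)

S₅ : List (Vec ℤ 4)
S₅ = (- + 1 ∷ + 3 ∷ + 1 ∷ - + 3 ∷ [])
   ∷ (- + 1 ∷ + 4 ∷ + 1 ∷ - + 3 ∷ [])
   ∷ (- + 1 ∷ + 4 ∷ + 0 ∷ - + 4 ∷ [])
   ∷ []

lookup-inverseCoeffs : ∀ s n (i : Fin (suc n)) →
  lookup (inverseCoeffs s n) i ≡ inverse s (n ∸ toℕ i)
lookup-inverseCoeffs s zero    zero    = refl
lookup-inverseCoeffs s (suc n) zero    = refl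
lookup-inverseCoeffs s (suc n) (suc i) = lookup-inverseCoeffs s n i

⊛-inverse : ∀ s → s 0 ≡ 1ℤ → ∀ n → (s ⊛ inverse s) n ≡ one n
⊛-inverse s s₀ zero    rewrite s₀ = refl
⊛-inverse s s₀ (suc n) = begin
  s 0 * inverse s (suc n) + ∑[ i ≤ n ] (s (suc (toℕ i)) * inverse s (n ∸ toℕ i))
    ≡⟨ cong₂ _+_
         (trans (cong (_* inverse s (suc n)) s₀) (*-identityˡ (inverse s (suc n))))
         (sum-cong-≗ {suc n} λ i →
           cong (s (suc (toℕ i)) *_) (sym (lookup-inverseCoeffs s n i))) ⟩
  - Σ + Σ
    ≡⟨ +-inverseˡ Σ ⟩
  0ℤ ∎
  where
  open ≡-Reasoning
  Σ = ∑[ i ≤ n ] (s (suc (toℕ i)) * lookup (inverseCoeffs s n) i)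

^ℕ-constantTerm : ∀ s k → s 0 ≡ 1ℤ → (s ^ℕ k) 0 ≡ 1ℤ
^ℕ-constantTerm s zero    s₀ = refl
^ℕ-constantTerm s (suc k) s₀ rewrite s₀ | ^ℕ-constantTerm s k s₀ = refl

^ℤ-inverse : ∀ j k n →
  (f j ^ℕ suc k ⊛ f j ^ℤ -[1+ k ]) n ≡ one n
^ℤ-inverse j k = ⊛-inverse (f j ^ℕ suc k) (^ℕ-constantTerm (f j) (suc k) refl)

q^-below : ∀ {d n} → n ℕ.< d → q^ d n ≡ 0ℤ
q^-below {suc d} {zero}  _           = refl
q^-below {suc d} {suc n} (ℕ.s≤s n<d) = q^-below n<d

1-q^-⊛-below : ∀ {d n} s → n ℕ.< d → (1-q^ d ⊛ s) n ≡ s n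
1-q^-⊛-below {suc d} {zero}  s _   = trans (+-identityʳ _) (*-identityˡ (s 0))
1-q^-⊛-below {suc d} {suc n} s n<d = begin
  1ℤ * s (suc n) + ∑[ i ≤ n ] (1-q^ (suc d) (suc (toℕ i)) * s (n ∸ toℕ i))
    ≡⟨ cong₂ _+_ (*-identityˡ (s (suc n))) (sum-cong-≗ {suc n} vanish) ⟩
  s (suc n) + ∑[ i ≤ n ] 0ℤ
    ≡⟨ cong (_+_ (s (suc n))) (sum-replicate-zero (suc n)) ⟩
  s (suc n) + 0ℤ
    ≡⟨ +-identityʳ (s (suc n)) ⟩
  s (suc n) ∎
  where
  open ≡-Reasoning
  vanish : ∀ i → 1-q^ (suc d) (suc (toℕ i)) * s (n ∸ toℕ i) ≡ 0ℤ
  vanish i = trans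
    (cong (λ x → (0ℤ - x) * s (n ∸ toℕ i))
      (q^-below (ℕ.≤-<-trans (toℕ<n i) n<d)))
    (*-zeroˡ (s (n ∸ toℕ i)))

f-limit : ∀ j .{{_ : NonZero j}} n k → partialProduct j (k ℕ.+ n) n ≡ f j n
f-limit j n zero    = refl
f-limit j n (suc k) = trans
  (1-q^-⊛-below (partialProduct j (k ℕ.+ n)) $
    ℕ.<-≤-trans (ℕ.s≤s (ℕ.m≤n+m n k)) (ℕ.m≤n*m (suc (k ℕ.+ n)) j))
  (f-limit j n k)

{-# OPTIONS --safe #-}

-- Write τ for q ↦ −q². If s = τ E + q τ O with E and O positive, then the signs of s
-- have period 4 and pattern + + − −. Such a dissection of the three eta quotients comes from
-- Ramanujan's theta function f(x, y) = ∑ₙ x^{n(n+1)/2} y^{n(n−1)/2}: splitting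
--   f(q, q⁵) = f(q⁸, q¹⁶) + q f(q⁴, q²⁰),   f(q, q³) = f(q⁶, q¹⁰) + q f(q², q¹⁴)
-- into even and odd terms. By the Jacobi triple product, f(q, q⁵) = f₂² f₃ f₁₂ / (f₁ f₄ f₆)
-- and f(q, q³) = f₂² / f₁, so that each quotient is one of these theta functions times an even
-- function. The resulting E and O factor into products of 1 + q^d, 1 + q^d + q^{2d},
-- 1 / (1 − q^d) and theta functions, which have nonnegative coefficients.
-- Modulo q^L all products are finite, so it suffices to work modulo q^L for every L.
module Submission where

open import Defs
open import Data.Integer.Base using (ℤ; 0ℤ; _<_; _>_)
open import Data.List.Membership.Propositional using (_∈_)
open import Data.Nat.Base using (ℕ; _+_; _*_)
open import Data.Product.Base using (_×_)
open import Data.Vec.Base using (Vec)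

open import Algebra.Bundles using (CommutativeMonoid; CommutativeRing)
open import Algebra.Structures using (IsCommutativeRing)
open import Data.Fin.Base using (toℕ)
open import Data.Fin.Properties using (toℕ<n)
open import Data.Integer.Base as ℤ using (1ℤ)
import Data.Integer.Properties as ℤ
open import Algebra.Properties.CommutativeSemigroup ℤ.+-commutativeSemigroup
  using (interchange; x∙yz≈y∙xz)
open import Algebra.Properties.Monoid.Sum ℤ.+-0-monoid using (sum-cong-≗)
open import Data.List.Base using (List; []; _∷_; _++_; concatMap; replicate)
open import Data.List.Relation.Binary.Permutation.Propositional as Perm
  using (_↭_; ↭-sym; ↭-trans; ↭-reflexive)
open import Data.List.Relation.Unary.All as All using (All)
open import Data.List.Relation.Unary.Any using (here; there)
open import Data.Nat.Base as ℕ using (zero; suc; NonZero)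
open import Data.Nat.Induction using (<-rec)
import Data.Nat.Properties as ℕ
open import Data.List.Sort.InsertionSort ℕ.≤-decTotalOrder using (sort)
open import Data.List.Sort.InsertionSort.Properties ℕ.≤-decTotalOrder using (sort-↭)
open import Data.Nat.Tactic.RingSolver using (solve)
open import Data.Parity.Base using (0ℙ; 1ℙ)
open import Data.Product.Base using (_,_; proj₁; proj₂)
open import Data.Sum.Base using (inj₁; inj₂)
open import Function.Base using (_∘_; flip)
open import Level using (0ℓ)
open import Relation.Binary.PropositionalEquality as ≡ using (_≡_; _≗_; cong; cong₂)
open import Relation.Nullary.Decidable using (True; toWitness)

-- To write the two parts of a quotient as values of τ, E and O are found by replacing q² with -q in
-- these parts, and the resulting identities are then checked forwards: τ is a ring homomorphism and
-- sends each f_j to an eta quotient. Equality of eta quotients is cross-multiplication: two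
-- multisets of indices must coincide, which evaluation decides once they are sorted. Theta
-- functions are needed in both forms, the product for the comparison with eta quotients and the sum
-- for the dissection and for nonnegativity. Nonnegative factors alone give only weak inequalities.
-- Strictness comes from ∏ (1 + q^k), all of whose coefficients are positive, or, for the second
-- quotient, from ∏ (1 + q^(2k-1)) times a series whose coefficient of q is positive. The remaining
-- factors preserve it because their constant term is 1.

infixl 6 _⊕_
infixl 7 _⊗_
infixr 7 _·_
infix 8 ⊖_

-- The ring laws for formal power series

-- Series is a function type, so unification η-expands and unfolds equations between
-- series; keeping the ring operations opaque lets it solve them structurally.
opaque
  _⊕_ _⊗_ : Series → Series → Series
  (s ⊕ u) n = s n ℤ.+ u n
  s ⊗ u = s ⊛ u

  ⊖_ : Series → Series
  (⊖ s) n = ℤ.- s n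

𝟘 : Series
𝟘 n = 0ℤ

_·_ : ℤ → Series → Series
(c · s) n = c ℤ.* s n

-- By computation, `tail (s ⊛ u)` is `s 0 · tail u` plus `tail s ⊛ u`. This recursion drives the
-- inductions on the degree below.
tail : Series → Series
tail s n = s (suc n)

⊛-cong-≤ : ∀ {s s′ u u′} n → (∀ {m} → m ℕ.≤ n → s m ≡ s′ m) →
  (∀ {m} → m ℕ.≤ n → u m ≡ u′ m) → (s ⊛ u) n ≡ (s′ ⊛ u′) n
⊛-cong-≤ n s≡ u≡ = sum-cong-≗ {suc n} λ i →
  cong₂ ℤ._*_ (s≡ (ℕ.s≤s⁻¹ (toℕ<n i))) (u≡ (ℕ.m∸n≤m n (toℕ i)))

⊛-zeroˡ : ∀ s → 𝟘 ⊛ s ≗ 𝟘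
⊛-zeroˡ s zero    = ≡.refl
⊛-zeroˡ s (suc n) = ≡.trans (ℤ.+-identityˡ _) (⊛-zeroˡ s n)

⊛-identityˡ : ∀ s → one ⊛ s ≗ s
⊛-identityˡ s zero    = ≡.trans (ℤ.+-identityʳ _) (ℤ.*-identityˡ (s 0))
⊛-identityˡ s (suc n) = ≡.trans
  (cong₂ ℤ._+_ (ℤ.*-identityˡ (s (suc n))) (⊛-zeroˡ s n)) (ℤ.+-identityʳ _)

opaque
  unfolding _⊕_

  ⊛-distribʳ : ∀ s u v → (s ⊕ u) ⊛ v ≗ s ⊛ v ⊕ u ⊛ v
  ⊛-distribʳ s u v zero    = begin
    (s 0 ℤ.+ u 0) ℤ.* v 0 ℤ.+ 0ℤ                    ≡⟨ ℤ.+-identityʳ _ ⟩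
    (s 0 ℤ.+ u 0) ℤ.* v 0                           ≡⟨ ℤ.*-distribʳ-+ (v 0) (s 0) (u 0) ⟩
    s 0 ℤ.* v 0 ℤ.+ u 0 ℤ.* v 0
      ≡⟨ cong₂ ℤ._+_ (ℤ.+-identityʳ (s 0 ℤ.* v 0)) (ℤ.+-identityʳ (u 0 ℤ.* v 0)) ⟨
    (s 0 ℤ.* v 0 ℤ.+ 0ℤ) ℤ.+ (u 0 ℤ.* v 0 ℤ.+ 0ℤ)   ∎
    where open ≡.≡-Reasoning
  ⊛-distribʳ s u v (suc n) = ≡.trans
    (cong₂ ℤ._+_ (ℤ.*-distribʳ-+ (v (suc n)) (s 0) (u 0)) (⊛-distribʳ (tail s) (tail u) v n))
    (interchange (s 0 ℤ.* v (suc n)) _ _ _)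

·-⊛ : ∀ c s u → (c · s) ⊛ u ≗ c · (s ⊛ u)
·-⊛ c s u zero    = begin
  c ℤ.* s 0 ℤ.* u 0 ℤ.+ 0ℤ     ≡⟨ ℤ.+-identityʳ _ ⟩
  c ℤ.* s 0 ℤ.* u 0            ≡⟨ ℤ.*-assoc c (s 0) (u 0) ⟩
  c ℤ.* (s 0 ℤ.* u 0)          ≡⟨ cong (c ℤ.*_) (ℤ.+-identityʳ (s 0 ℤ.* u 0)) ⟨
  c ℤ.* (s 0 ℤ.* u 0 ℤ.+ 0ℤ)   ∎
  where open ≡.≡-Reasoning
·-⊛ c s u (suc n) = ≡.trans
  (cong₂ ℤ._+_ (ℤ.*-assoc c (s 0) (u (suc n))) (·-⊛ c (tail s) u n))
  (≡.sym (ℤ.*-distribˡ-+ c (s 0 ℤ.* u (suc n)) _))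

-- Splits off the last summand of the convolution, where the definition splits off the first;
-- commutativity compares the two.
⊛-suc : ∀ s u n → (s ⊛ u) (suc n) ≡ s (suc n) ℤ.* u 0 ℤ.+ (s ⊛ tail u) n
⊛-suc s u zero    = begin
  s 0 ℤ.* u 1 ℤ.+ (s 1 ℤ.* u 0 ℤ.+ 0ℤ)  ≡⟨ x∙yz≈y∙xz (s 0 ℤ.* u 1) (s 1 ℤ.* u 0) 0ℤ ⟩
  s 1 ℤ.* u 0 ℤ.+ (s 0 ℤ.* u 1 ℤ.+ 0ℤ)  ∎
  where open ≡.≡-Reasoning
⊛-suc s u (suc n) = ≡.trans
  (cong (ℤ._+_ (s 0 ℤ.* u (suc (suc n)))) (⊛-suc (tail s) u n))
  (x∙yz≈y∙xz (s 0 ℤ.* u (suc (suc n))) (s (suc (suc n)) ℤ.* u 0) _)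

⊛-comm : ∀ s u → s ⊛ u ≗ u ⊛ s
⊛-comm s u zero    = cong (ℤ._+ 0ℤ) (ℤ.*-comm (s 0) (u 0))
⊛-comm s u (suc n) = ≡.trans
  (cong₂ ℤ._+_ (ℤ.*-comm (s 0) (u (suc n))) (⊛-comm (tail s) u n))
  (≡.sym (⊛-suc u s n))

opaque
  unfolding _⊕_

  ⊛-assoc : ∀ s u v → (s ⊛ u) ⊛ v ≗ s ⊛ (u ⊛ v)
  ⊛-assoc s u v zero    = cong (ℤ._+ 0ℤ) (begin
    (s 0 ℤ.* u 0 ℤ.+ 0ℤ) ℤ.* v 0   ≡⟨ cong (ℤ._* v 0) (ℤ.+-identityʳ (s 0 ℤ.* u 0)) ⟩
    s 0 ℤ.* u 0 ℤ.* v 0            ≡⟨ ℤ.*-assoc (s 0) (u 0) (v 0) ⟩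
    s 0 ℤ.* (u 0 ℤ.* v 0)          ≡⟨ cong (s 0 ℤ.*_) (ℤ.+-identityʳ (u 0 ℤ.* v 0)) ⟨
    s 0 ℤ.* (u 0 ℤ.* v 0 ℤ.+ 0ℤ)   ∎)
    where open ≡.≡-Reasoning
  ⊛-assoc s u v (suc n) = begin
    (s ⊛ u) 0 ℤ.* v (suc n) ℤ.+ (tail (s ⊛ u) ⊛ v) n
      ≡⟨⟩
    (s ⊛ u) 0 ℤ.* v (suc n) ℤ.+ ((s 0 · tail u ⊕ tail s ⊛ u) ⊛ v) n
      ≡⟨ cong₂ ℤ._+_ (cong (ℤ._* v (suc n)) (ℤ.+-identityʳ (s 0 ℤ.* u 0)))
           (⊛-distribʳ (s 0 · tail u) (tail s ⊛ u) v n) ⟩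
    s 0 ℤ.* u 0 ℤ.* v (suc n) ℤ.+ (((s 0 · tail u) ⊛ v) n ℤ.+ ((tail s ⊛ u) ⊛ v) n)
      ≡⟨ cong₂ ℤ._+_ (ℤ.*-assoc (s 0) (u 0) (v (suc n)))
           (cong₂ ℤ._+_ (·-⊛ (s 0) (tail u) v n) (⊛-assoc (tail s) u v n)) ⟩
    s 0 ℤ.* (u 0 ℤ.* v (suc n)) ℤ.+ (s 0 ℤ.* (tail u ⊛ v) n ℤ.+ (tail s ⊛ (u ⊛ v)) n)
      ≡⟨ ℤ.+-assoc (s 0 ℤ.* (u 0 ℤ.* v (suc n))) _ _ ⟨
    s 0 ℤ.* (u 0 ℤ.* v (suc n)) ℤ.+ s 0 ℤ.* (tail u ⊛ v) n ℤ.+ (tail s ⊛ (u ⊛ v)) n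
      ≡⟨ cong (ℤ._+ (tail s ⊛ (u ⊛ v)) n)
           (ℤ.*-distribˡ-+ (s 0) (u 0 ℤ.* v (suc n)) ((tail u ⊛ v) n)) ⟨
    s 0 ℤ.* (u ⊛ v) (suc n) ℤ.+ (tail s ⊛ (u ⊛ v)) n  ∎
    where open ≡.≡-Reasoning

-- Congruence modulo q^L

module Modulo (L : ℕ) where

  infix 4 _≈_

  record _≈_ (s u : Series) : Set where
    constructor below
    field
      coeff : ∀ {n} → n ℕ.< L → s n ≡ u n

  open _≈_ public

  ≗⇒≈ : ∀ {s u} → s ≗ u → s ≈ u
  ≗⇒≈ s≗u = below λ {n} _ → s≗u n

  opaque
    unfolding _⊕_

    ⊗-cong : ∀ {s s′ u u′} → s ≈ s′ → u ≈ u′ → s ⊗ u ≈ s′ ⊗ u′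
    ⊗-cong s≈ u≈ = below λ {n} n<L → ⊛-cong-≤ n
      (λ m≤n → coeff s≈ (ℕ.≤-<-trans m≤n n<L)) (λ m≤n → coeff u≈ (ℕ.≤-<-trans m≤n n<L))

    isCommutativeRing : IsCommutativeRing _≈_ _⊕_ _⊗_ ⊖_ 𝟘 one
    isCommutativeRing = record
      { isRing = record
        { +-isAbelianGroup = record
          { isGroup = record
            { isMonoid = record
              { isSemigroup = record
                { isMagma = record
                  { isEquivalence = record
                    { refl = below λ _ → ≡.refl
                    ; sym = λ p → below λ n<L → ≡.sym (coeff p n<L)
                    ; trans = λ p r → below λ n<L → ≡.trans (coeff p n<L) (coeff r n<L)
                    }
                  ; ∙-cong = λ p r → below λ n<L → cong₂ ℤ._+_ (coeff p n<L) (coeff r n<L)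
                  }
                ; assoc = λ s u v → ≗⇒≈ λ n → ℤ.+-assoc (s n) (u n) (v n)
                }
              ; identity = (λ s → ≗⇒≈ λ n → ℤ.+-identityˡ (s n))
                         , (λ s → ≗⇒≈ λ n → ℤ.+-identityʳ (s n))
              }
            ; inverse = (λ s → ≗⇒≈ λ n → ℤ.+-inverseˡ (s n)) , (λ s → ≗⇒≈ λ n → ℤ.+-inverseʳ (s n))
            ; ⁻¹-cong = λ p → below λ n<L → cong ℤ.-_ (coeff p n<L)
            }
          ; comm = λ s u → ≗⇒≈ λ n → ℤ.+-comm (s n) (u n)
          }
        ; *-cong = ⊗-cong
        ; *-assoc = λ s u v → ≗⇒≈ (⊛-assoc s u v)
        ; *-identity = (λ s → ≗⇒≈ (⊛-identityˡ s))
                     , λ s → ≗⇒≈ λ n → ≡.trans (⊛-comm s one n) (⊛-identityˡ s n)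
        ; distrib = (λ s u v → ≗⇒≈ λ n → begin
              (s ⊛ (u ⊕ v)) n              ≡⟨ ⊛-comm s (u ⊕ v) n ⟩
              ((u ⊕ v) ⊛ s) n              ≡⟨ ⊛-distribʳ u v s n ⟩
              (u ⊛ s) n ℤ.+ (v ⊛ s) n      ≡⟨ cong₂ ℤ._+_ (⊛-comm u s n) (⊛-comm v s n) ⟩
              (s ⊛ u) n ℤ.+ (s ⊛ v) n      ∎)
          , λ s u v → ≗⇒≈ (⊛-distribʳ u v s)
        }
      ; *-comm = λ s u → ≗⇒≈ (⊛-comm s u)
      }
      where open ≡.≡-Reasoning

  ring : CommutativeRing 0ℓ 0ℓ
  ring = record { isCommutativeRing = isCommutativeRing }

-- Finite sums and products over an initial segment of ℕ

fold : {A : Set} → (A → A → A) → A → ℕ → (ℕ → A) → A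
fold _∙_ ε zero    h = ε
fold _∙_ ε (suc K) h = h K ∙ fold _∙_ ε K h

module Fold (M : CommutativeMonoid 0ℓ 0ℓ) where
  open CommutativeMonoid M
  open import Algebra.Properties.CommutativeSemigroup commutativeSemigroup
    using () renaming (interchange to ∙-interchange)
  open import Relation.Binary.Reasoning.Setoid setoid

  private
    F : ℕ → (ℕ → Carrier) → Carrier
    F = fold _∙_ ε

  fold-cong : ∀ K {g h} → (∀ {i} → i ℕ.< K → g i ≈ h i) → F K g ≈ F K h
  fold-cong zero    g≈h = refl
  fold-cong (suc K) g≈h = ∙-cong (g≈h (ℕ.n<1+n K)) (fold-cong K (g≈h ∘ ℕ.m<n⇒m<1+n))

  fold-ε : ∀ K → F K (λ _ → ε) ≈ ε
  fold-ε zero    = refl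
  fold-ε (suc K) = trans (identityˡ _) (fold-ε K)

  fold-∙ : ∀ K g h → F K (λ i → g i ∙ h i) ≈ F K g ∙ F K h
  fold-∙ zero    g h = sym (identityˡ ε)
  fold-∙ (suc K) g h = trans (∙-congˡ (fold-∙ K g h)) (∙-interchange (g K) (h K) (F K g) (F K h))

  fold-swap : ∀ K k (h : ℕ → ℕ → Carrier) → F K (λ i → F k (h i)) ≈ F k (λ r → F K (λ i → h i r))
  fold-swap zero    k h = sym (fold-ε k)
  fold-swap (suc K) k h = trans (∙-congˡ (fold-swap K k h))
    (sym (fold-∙ k (h K) (λ r → F K (λ i → h i r))))

  fold-+ : ∀ k m h → F (k + m) h ≈ F k (λ i → h (i + m)) ∙ F m h
  fold-+ zero    m h = sym (identityˡ _)
  fold-+ (suc k) m h = trans (∙-congˡ (fold-+ k m h)) (sym (assoc _ _ _))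

  -- Regroups the indices by their residue r modulo k. For products it splits arithmetic
  -- progressions, for sums with k = 2 it is the even/odd dissection.
  fold-* : ∀ K k h → F (K * k) h ≈ F k (λ r → F K (λ i → h (r + i * k)))
  fold-* K k h = trans (blocks K) (fold-swap K k (λ i r → h (r + i * k)))
    where
    blocks : ∀ K → F (K * k) h ≈ F K (λ i → F k (λ r → h (r + i * k)))
    blocks zero    = refl
    blocks (suc K) = trans (fold-+ k (K * k) h) (∙-congˡ (blocks K))

  fold-stable : ∀ {K L} h → L ℕ.≤ K → (∀ {i} → L ℕ.≤ i → h i ≈ ε) → F K h ≈ F L h
  fold-stable {K} {L} h L≤K h≈ε =
    ≡.subst (λ K → F K h ≈ F L h) (ℕ.m∸n+n≡m L≤K) (go (K ℕ.∸ L))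
    where
    go : ∀ k → F (k + L) h ≈ F L h
    go zero    = refl
    go (suc k) = trans (∙-cong (h≈ε (ℕ.m≤n+m L k)) (go k)) (identityˡ _)

∏ ∑ : ℕ → (ℕ → Series) → Series
∏ = fold _⊗_ one
∑ = fold _⊕_ 𝟘

antidiagonal : ℕ → (ℕ → ℕ → Series) → Series
antidiagonal zero    g = g 0 0
antidiagonal (suc m) g = g 0 (suc m) ⊕ antidiagonal m (λ i → g (suc i))

1+q^ : ℕ → Series
1+q^ d = one ⊕ q^ d

opaque
  unfolding _⊗_

  ⊗-constantTerm : ∀ {s u} → s 0 ≡ 1ℤ → u 0 ≡ 1ℤ → (s ⊗ u) 0 ≡ 1ℤ
  ⊗-constantTerm s₀ u₀ rewrite s₀ | u₀ = ≡.refl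

  q^-⊗ : ∀ d e → q^ d ⊗ q^ e ≗ q^ (d + e)
  q^-⊗ zero    e n       = ⊛-identityˡ (q^ e) n
  q^-⊗ (suc d) e zero    = ≡.refl
  q^-⊗ (suc d) e (suc n) = ≡.trans (ℤ.+-identityˡ _) (q^-⊗ d e n)

  partialProduct-∏ : ∀ j K → partialProduct j K ≡ ∏ K (λ i → 1-q^ (j * suc i))
  partialProduct-∏ j zero    = ≡.refl
  partialProduct-∏ j (suc K) = cong (1-q^ (j * suc K) ⊛_) (partialProduct-∏ j K)

  ⊗-inverse : ∀ s → s 0 ≡ 1ℤ → s ⊗ inverse s ≗ one
  ⊗-inverse = ⊛-inverse

∏-constantTerm : ∀ K {h} → (∀ i → h i 0 ≡ 1ℤ) → ∏ K h 0 ≡ 1ℤ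
∏-constantTerm zero    h₀ = ≡.refl
∏-constantTerm (suc K) h₀ = ⊗-constantTerm (h₀ K) (∏-constantTerm K h₀)

-- Exponents in the Jacobi triple product

-- The exponent of the triple product's term indexed by k − s: with M = c + d,
-- exponent M c d k s = M n(n − 1)/2 + c n for n = k − s ∈ ℤ.
triangle : ℕ → ℕ → ℕ → ℕ
triangle M c zero    = 0
triangle M c (suc k) = M * k + c + triangle M c k

exponent : ℕ → ℕ → ℕ → ℕ → ℕ → ℕ
exponent M c d zero    s       = triangle M d s
exponent M c d (suc k) zero    = triangle M c (suc k)
exponent M c d (suc k) (suc s) = exponent M c d k s

exponent-zero : ∀ M c d k → exponent M c d k 0 ≡ triangle M c k
exponent-zero M c d zero    = ≡.refl
exponent-zero M c d (suc k) = ≡.refl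

exponent-+ : ∀ M c d k j → exponent M c d k (k + j) ≡ triangle M d j
exponent-+ M c d zero    j = ≡.refl
exponent-+ M c d (suc k) j = exponent-+ M c d k j

-- Moving the centre from s to s + 1 replaces n by n - 1, and the exponents at n and n - 1 differ by
-- M (n - 1) + c = M (k - s) - d.
exponent-suc : ∀ M c d → c + d ≡ M → ∀ k s →
  M * s + d + exponent M c d k s ≡ M * k + exponent M c d k (suc s)
exponent-suc M c d _ zero    s       =
  cong (_+ (M * s + d + triangle M d s)) (≡.sym (ℕ.*-zeroʳ M))
exponent-suc M c d ≡.refl (suc k) zero    rewrite exponent-zero (c + d) c d k =
  lemma (triangle (c + d) c k)
  where
  lemma : ∀ t → (c + d) * 0 + d + ((c + d) * k + c + t) ≡ (c + d) * suc k + t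
  lemma t = solve (c ∷ d ∷ k ∷ t ∷ [])
exponent-suc M c d c+d≡M (suc k) (suc s) = begin
  M * suc s + d + e     ≡⟨ lemma s ⟩
  M + (M * s + d + e)   ≡⟨ cong (M +_) (exponent-suc M c d c+d≡M k s) ⟩
  M + (M * k + e′)      ≡⟨ ℕ.+-assoc M (M * k) e′ ⟨
  M + M * k + e′        ≡⟨ cong (_+ e′) (ℕ.*-suc M k) ⟨
  M * suc k + e′        ∎
  where
  open ≡.≡-Reasoning
  e = exponent M c d k s
  e′ = exponent M c d k (suc s)
  lemma : ∀ s → M * suc s + d + e ≡ M + (M * s + d + e)
  lemma s = ≡.trans (cong (λ y → y + d + e) (ℕ.*-suc M s))
    (≡.trans (cong (_+ e) (ℕ.+-assoc M (M * s) d)) (ℕ.+-assoc M (M * s + d) e))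

k≤triangle : ∀ M c .{{_ : NonZero c}} k → k ℕ.≤ triangle M c k
k≤triangle M c zero    = ℕ.z≤n
k≤triangle M c (suc k) =
  ℕ.+-mono-≤ (ℕ.≤-trans (ℕ.>-nonZero⁻¹ c) (ℕ.m≤n+m c (M * k))) (k≤triangle M c k)

-- With `s≤exponent+k` this bounds the exponent below by |k - s|, so the terms far from the centre
-- vanish modulo q^L.
k≤exponent+s : ∀ M c d .{{_ : NonZero c}} k s → k ℕ.≤ exponent M c d k s + s
k≤exponent+s M c d zero    s       = ℕ.z≤n
k≤exponent+s M c d (suc k) zero    = ℕ.≤-trans (k≤triangle M c (suc k)) (ℕ.m≤m+n _ 0)
k≤exponent+s M c d (suc k) (suc s) =
  ℕ.≤-trans (ℕ.s≤s (k≤exponent+s M c d k s)) (ℕ.≤-reflexive (≡.sym (ℕ.+-suc _ s)))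

s≤exponent+k : ∀ M c d .{{_ : NonZero d}} k s → s ℕ.≤ exponent M c d k s + k
s≤exponent+k M c d zero    s       = ℕ.≤-trans (k≤triangle M d s) (ℕ.m≤m+n _ 0)
s≤exponent+k M c d (suc k) zero    = ℕ.z≤n
s≤exponent+k M c d (suc k) (suc s) =
  ℕ.≤-trans (ℕ.s≤s (s≤exponent+k M c d k s)) (ℕ.≤-reflexive (≡.sym (ℕ.+-suc _ k)))

triangle-even : ∀ M c k → triangle M c (k * 2) ≡ triangle (4 * M) (M + 2 * c) k
triangle-even M c zero    = ≡.refl
triangle-even M c (suc k) rewrite ≡.sym (triangle-even M c k) = lemma (triangle M c (k * 2))
  where
  lemma : ∀ t → M * (1 + k * 2) + c + (M * (k * 2) + c + t) ≡ 4 * M * k + (M + 2 * c) + t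
  lemma t = solve (M ∷ c ∷ k ∷ t ∷ [])

-- Putting n = 2n′ in M n(n - 1)/2 + c n gives 4M n′(n′ - 1)/2 + (M + 2c) n′.
exponent-even : ∀ M c d k s →
  exponent M c d (k * 2) (s * 2) ≡ exponent (4 * M) (M + 2 * c) (M + 2 * d) k s
exponent-even M c d zero    s       = triangle-even M d s
exponent-even M c d (suc k) zero    = triangle-even M c (suc k)
exponent-even M c d (suc k) (suc s) = exponent-even M c d k s

triangle-odd : ∀ M c k →
  triangle M c (1 + k * 2) ≡ c + triangle (4 * M) (3 * M + 2 * c) k
triangle-odd M c zero    = cong (λ x → x + c + 0) (ℕ.*-zeroʳ M)
triangle-odd M c (suc k) rewrite triangle-odd M c k = lemma (triangle (4 * M) (3 * M + 2 * c) k)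
  where
  lemma : ∀ t → M * (2 + k * 2) + c + (M * (1 + k * 2) + c + (c + t)) ≡
                c + (4 * M * k + (3 * M + 2 * c) + t)
  lemma t = solve (M ∷ c ∷ k ∷ t ∷ [])

-- Putting n = 2n′ + 1 gives c + 4M n′(n′ - 1)/2 + (3M + 2c) n′. The exponent complementary to 3M +
-- 2c in 4M is M - 2c = d - c; parametrising by e = d - c avoids the subtraction.
exponent-odd : ∀ c e k s → let d = c + e; M = c + d in
  exponent M c d (1 + k * 2) (s * 2) ≡ c + exponent (4 * M) (3 * M + 2 * c) e k s
exponent-odd c e zero    zero    = triangle-odd (c + (c + e)) c 0
exponent-odd c e (suc k) zero    = triangle-odd (c + (c + e)) c (suc k)
exponent-odd c e (suc k) (suc s) = exponent-odd c e k s
exponent-odd c e zero    (suc s) = negative s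
  where
  lemma : ∀ s t →
    (c + (c + e)) * (2 + s * 2) + (c + e) + ((c + (c + e)) * (1 + s * 2) + (c + e) + (c + t)) ≡
    c + (4 * (c + (c + e)) * (1 + s) + e + t)
  lemma s t = solve (c ∷ e ∷ s ∷ t ∷ [])
  lemma₀ : (c + (c + e)) * 0 + (c + e) + 0 ≡ c + (4 * (c + (c + e)) * 0 + e + 0)
  lemma₀ = solve (c ∷ e ∷ [])
  negative : ∀ s → triangle (c + (c + e)) (c + e) (1 + s * 2) ≡
                c + triangle (4 * (c + (c + e))) e (suc s)
  negative zero    = lemma₀
  negative (suc s) rewrite negative s = lemma s (triangle (4 * (c + (c + e))) e (suc s))

-- Products and antidiagonal sums modulo q^L

module Products (L : ℕ) where
  open Modulo L public
  open CommutativeRing ring public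
    using ( setoid; refl; sym; trans; reflexive; *-congˡ; *-congʳ; *-assoc; *-comm
          ; *-identityˡ; *-identityʳ; +-cong; +-congˡ; +-congʳ; +-assoc; +-comm
          ; +-identityˡ; +-identityʳ; -‿cong; -‿inverseˡ; distribˡ; distribʳ; zeroˡ; zeroʳ )
  open import Algebra.Properties.CommutativeSemigroup (CommutativeRing.*-commutativeSemigroup ring)
    public using () renaming (x∙yz≈y∙xz to x⊗yz≈y⊗xz; interchange to ⊗-interchange)
  open import Algebra.Properties.CommutativeSemigroup (CommutativeRing.+-commutativeSemigroup ring)
    using () renaming (x∙yz≈y∙xz to x+yz≈y+xz; interchange to +-interchange)
  open import Algebra.Properties.Ring (CommutativeRing.ring ring) public
    using (-‿distribˡ-*; -‿involutive; -0#≈0#)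
  open import Algebra.Solver.CommutativeMonoid (CommutativeRing.*-commutativeMonoid ring) public
    using (_⊜_) renaming (solve to solve-⊗; _⊕_ to _⊙_)
  open Fold (CommutativeRing.*-commutativeMonoid ring) public
    using () renaming (fold-cong to ∏-cong; fold-∙ to ∏-⊗; fold-* to ∏-*; fold-stable to ∏-stable)
  open Fold (CommutativeRing.+-commutativeMonoid ring) public
    using () renaming (fold-cong to ∑-cong; fold-* to ∑-*)
  open import Relation.Binary.Reasoning.Setoid setoid

  ⊗-inverseʳ : ∀ s → s 0 ≡ 1ℤ → s ⊗ inverse s ≈ one
  ⊗-inverseʳ s s₀ = ≗⇒≈ (⊗-inverse s s₀)

  ⊗-cancelˡ : ∀ s {u v} → s 0 ≡ 1ℤ → s ⊗ u ≈ s ⊗ v → u ≈ v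
  ⊗-cancelˡ s {u} {v} s₀ su≈sv = begin
    u                     ≈⟨ expand u ⟩
    inverse s ⊗ (s ⊗ u)   ≈⟨ *-congˡ su≈sv ⟩
    inverse s ⊗ (s ⊗ v)   ≈⟨ expand v ⟨
    v                     ∎
    where
    expand : ∀ u → u ≈ inverse s ⊗ (s ⊗ u)
    expand u = begin
      u                     ≈⟨ *-identityˡ u ⟨
      one ⊗ u               ≈⟨ *-congʳ (trans (*-comm (inverse s) s) (⊗-inverseʳ s s₀)) ⟨
      inverse s ⊗ s ⊗ u     ≈⟨ *-assoc (inverse s) s u ⟩
      inverse s ⊗ (s ⊗ u)   ∎

  q^-+ : ∀ {m n k} → m + n ≡ k → q^ m ⊗ q^ n ≈ q^ k
  q^-+ {m} {n} ≡.refl = ≗⇒≈ (q^-⊗ m n)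

  q^-vanishes : ∀ {d} → L ℕ.≤ d → q^ d ≈ 𝟘
  q^-vanishes L≤d = below λ n<L → q^-below (ℕ.<-≤-trans n<L L≤d)

  antidiagonal-cong : ∀ m {g h} → (∀ i j → i + j ≡ m → g i j ≈ h i j) →
    antidiagonal m g ≈ antidiagonal m h
  antidiagonal-cong zero    g≈h = g≈h 0 0 ≡.refl
  antidiagonal-cong (suc m) g≈h = +-cong (g≈h 0 (suc m) ≡.refl)
    (antidiagonal-cong m λ i j i+j≡m → g≈h (suc i) j (cong suc i+j≡m))

  antidiagonal-⊕ : ∀ m g h →
    antidiagonal m (λ i j → g i j ⊕ h i j) ≈ antidiagonal m g ⊕ antidiagonal m h
  antidiagonal-⊕ zero    g h = refl
  antidiagonal-⊕ (suc m) g h = trans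
    (+-congˡ (antidiagonal-⊕ m (g ∘ suc) (h ∘ suc))) (+-interchange (g 0 (suc m)) (h 0 (suc m)) _ _)

  antidiagonal-⊗ : ∀ s m g → s ⊗ antidiagonal m g ≈ antidiagonal m (λ i j → s ⊗ g i j)
  antidiagonal-⊗ s zero    g = refl
  antidiagonal-⊗ s (suc m) g = trans (distribˡ s _ _) (+-congˡ (antidiagonal-⊗ s m (g ∘ suc)))

  -- Peels off the end j = 0, where the definition peels off i = 0; `partialTheta-step` needs both
  -- ends.
  antidiagonal-suc : ∀ m g →
    antidiagonal (suc m) g ≈ g (suc m) 0 ⊕ antidiagonal m (λ i j → g i (suc j))
  antidiagonal-suc zero    g = +-comm (g 0 1) (g 1 0)
  antidiagonal-suc (suc m) g = trans (+-congˡ (antidiagonal-suc m (g ∘ suc)))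
    (x+yz≈y+xz (g 0 (suc (suc m))) (g (suc (suc m)) 0) _)

  antidiagonal-flip : ∀ m g → antidiagonal m (flip g) ≈ antidiagonal m g
  antidiagonal-flip zero    g = refl
  antidiagonal-flip (suc m) g = trans
    (+-congˡ (antidiagonal-flip m (λ i j → g i (suc j)))) (sym (antidiagonal-suc m g))

  antidiagonal-∑ : ∀ m h → antidiagonal m (λ i _ → h i) ≈ ∑ (suc m) h
  antidiagonal-∑ zero    h = sym (+-identityʳ (h 0))
  antidiagonal-∑ (suc m) h = trans (antidiagonal-suc m (λ i _ → h i)) (+-congˡ (antidiagonal-∑ m h))

  1-q^0≈𝟘 : ∀ {d} → d ≡ 0 → 1-q^ d ≈ 𝟘
  1-q^0≈𝟘 ≡.refl = ≗⇒≈ λ n → ℤ.+-inverseʳ (one n)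

  opaque
    unfolding _⊕_

    1-q^-def : ∀ d → 1-q^ d ≈ one ⊕ ⊖ q^ d
    1-q^-def d = refl

1-q^-constantTerm : ∀ d .{{_ : NonZero d}} → 1-q^ d 0 ≡ 1ℤ
1-q^-constantTerm (suc d) = ≡.refl

partialProduct-constantTerm : ∀ j .{{_ : NonZero j}} K → partialProduct j K 0 ≡ 1ℤ
partialProduct-constantTerm j K rewrite partialProduct-∏ j K =
  ∏-constantTerm K λ i → 1-q^-constantTerm (j * suc i) {{ℕ.m*n≢0 j (suc i)}}

opaque
  unfolding _⊗_

  partialProduct-suc : ∀ j K → partialProduct j (suc K) ≡ 1-q^ (j * suc K) ⊗ partialProduct j K
  partialProduct-suc j K = ≡.refl

-- The Jacobi triple product

module TripleProduct (L : ℕ) where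
  open Products L
  open import Relation.Binary.Reasoning.Setoid setoid

  telescope : ∀ s u v → (s ⊕ ⊖ u) ⊕ (u ⊕ ⊖ v) ≈ s ⊕ ⊖ v
  telescope s u v = begin
    (s ⊕ ⊖ u) ⊕ (u ⊕ ⊖ v)   ≈⟨ +-assoc s (⊖ u) (u ⊕ ⊖ v) ⟩
    s ⊕ (⊖ u ⊕ (u ⊕ ⊖ v))   ≈⟨ +-congˡ (+-assoc (⊖ u) u (⊖ v)) ⟨
    s ⊕ ((⊖ u ⊕ u) ⊕ ⊖ v)   ≈⟨ +-congˡ (+-congʳ (-‿inverseˡ u)) ⟩
    s ⊕ (𝟘 ⊕ ⊖ v)           ≈⟨ +-congˡ (+-identityˡ (⊖ v)) ⟩
    s ⊕ ⊖ v                 ∎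

  1-q^-⊗ : ∀ d s → 1-q^ d ⊗ s ≈ s ⊕ ⊖ (q^ d ⊗ s)
  1-q^-⊗ d s = begin
    1-q^ d ⊗ s                  ≈⟨ *-congʳ (1-q^-def d) ⟩
    (one ⊕ ⊖ q^ d) ⊗ s          ≈⟨ distribʳ s one (⊖ q^ d) ⟩
    one ⊗ s ⊕ ⊖ q^ d ⊗ s        ≈⟨ +-cong (*-identityˡ s) (sym (-‿distribˡ-* (q^ d) s)) ⟩
    s ⊕ ⊖ (q^ d ⊗ s)            ∎

  -- Telescoping through q^a. This is the source of the q-Pascal rule below and of the
  -- factorisations of 1 - q^(2d) and 1 - q^(3d).
  1-q^-+ : ∀ {a b k} → a + b ≡ k → 1-q^ k ≈ 1-q^ a ⊕ q^ a ⊗ 1-q^ b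
  1-q^-+ {a} {b} {k} a+b≡k = begin
    1-q^ k                                        ≈⟨ 1-q^-def k ⟩
    one ⊕ ⊖ q^ k                                  ≈⟨ telescope one (q^ a) (q^ k) ⟨
    (one ⊕ ⊖ q^ a) ⊕ (q^ a ⊕ ⊖ q^ k)
      ≈⟨ +-cong (1-q^-def a) (+-congˡ (-‿cong (trans (*-comm _ _) (q^-+ a+b≡k)))) ⟨
    1-q^ a ⊕ (q^ a ⊕ ⊖ (q^ b ⊗ q^ a))             ≈⟨ +-congˡ (1-q^-⊗ b (q^ a)) ⟨
    1-q^ a ⊕ 1-q^ b ⊗ q^ a                        ≈⟨ +-congˡ (*-comm _ _) ⟩
    1-q^ a ⊕ q^ a ⊗ 1-q^ b                        ∎

  ⊗-inverse-cong : ∀ {s u} → s 0 ≡ 1ℤ → u 0 ≡ 1ℤ → s ≈ u → inverse s ≈ inverse u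
  ⊗-inverse-cong {s} {u} s₀ u₀ s≈u = ⊗-cancelˡ s s₀ (begin
    s ⊗ inverse s   ≈⟨ ⊗-inverseʳ s s₀ ⟩
    one             ≈⟨ ⊗-inverseʳ u u₀ ⟨
    u ⊗ inverse u   ≈⟨ *-congʳ s≈u ⟨
    s ⊗ inverse u   ∎)

  f-partialProduct : ∀ j .{{_ : NonZero j}} {K} → L ℕ.≤ K → partialProduct j K ≈ f j
  f-partialProduct j {K} L≤K = below λ {n} n<L →
    ≡.subst (λ K → partialProduct j K n ≡ f j n)
      (ℕ.m∸n+n≡m (ℕ.≤-trans (ℕ.<⇒≤ n<L) L≤K)) (f-limit j n (K ℕ.∸ n))

  module _ (M : ℕ) .{{_ : NonZero M}} where

    private
      u : ℕ → Series
      u k = inverse (partialProduct M k)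

      pp-u : ∀ k → partialProduct M k ⊗ u k ≈ one
      pp-u k = ⊗-inverseʳ (partialProduct M k) (partialProduct-constantTerm M k)

      u-suc : ∀ k → 1-q^ (M * suc k) ⊗ u (suc k) ≈ u k
      u-suc k = ⊗-cancelˡ (partialProduct M k) (partialProduct-constantTerm M k) (begin
        partialProduct M k ⊗ (1-q^ (M * suc k) ⊗ u (suc k))   ≈⟨ x⊗yz≈y⊗xz _ _ _ ⟩
        1-q^ (M * suc k) ⊗ (partialProduct M k ⊗ u (suc k))   ≈⟨ *-assoc _ _ _ ⟨
        1-q^ (M * suc k) ⊗ partialProduct M k ⊗ u (suc k)
          ≈⟨ *-congʳ (reflexive (partialProduct-suc M k)) ⟨
        partialProduct M (suc k) ⊗ u (suc k)                  ≈⟨ pp-u (suc k) ⟩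
        one                                                   ≈⟨ pp-u k ⟨
        partialProduct M k ⊗ u k                              ∎)

      -- Multiplied by `partialProduct M (i + j)`, the factor `u i ⊗ u j` is the q-binomial
      -- coefficient of i + j over i in base q^M.
      term : ℕ → ℕ → ℕ → ℕ → ℕ → Series
      term c d s i j = (u i ⊗ u j) ⊗ q^ (exponent M c d i s)

      partialTheta : ℕ → ℕ → ℕ → ℕ → Series
      partialTheta c d m s = antidiagonal m (term c d s)

    -- The q-Pascal rule. Write 1 - q^(M(i+j)) as (1 - q^(Mi)) + q^(Mi) (1 - q^(Mj)): the first
    -- summand cancels the last factor of `u i` and vanishes at i = 0, the second cancels that of
    -- `u j` and vanishes at j = 0. The first leaves n unchanged, the second shifts it by one, which
    -- produces q^(Ms+d).
    partialTheta-step : ∀ c d → c + d ≡ M → ∀ m s →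
      1-q^ (M * suc m) ⊗ partialTheta c d (suc m) (suc s) ≈ 1+q^ (M * s + d) ⊗ partialTheta c d m s
    partialTheta-step c d c+d≡M m s = begin
      1-q^ (M * suc m) ⊗ partialTheta c d (suc m) (suc s)
        ≈⟨ antidiagonal-⊗ _ (suc m) t ⟩
      antidiagonal (suc m) (λ i j → 1-q^ (M * suc m) ⊗ t i j)
        ≈⟨ antidiagonal-cong (suc m) split ⟩
      antidiagonal (suc m) (λ i j → α i j ⊕ β i j)
        ≈⟨ antidiagonal-⊕ (suc m) α β ⟩
      antidiagonal (suc m) α ⊕ antidiagonal (suc m) β
        ≈⟨ +-congˡ (antidiagonal-suc m β) ⟩
      (α 0 (suc m) ⊕ antidiagonal m (λ i j → α (suc i) j)) ⊕
        (β (suc m) 0 ⊕ antidiagonal m (λ i j → β i (suc j)))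
        ≈⟨ +-cong
             (+-cong (trans (*-congʳ (1-q^0≈𝟘 (ℕ.*-zeroʳ M))) (zeroˡ _))
               (antidiagonal-cong m λ i j _ → α-suc i j))
             (+-cong (trans (*-congˡ (trans (*-congʳ (1-q^0≈𝟘 (ℕ.*-zeroʳ M))) (zeroˡ _))) (zeroʳ _))
               (antidiagonal-cong m λ i j _ → β-suc i j)) ⟩
      (𝟘 ⊕ partialTheta c d m s) ⊕ (𝟘 ⊕ antidiagonal m (λ i j → q^ (M * s + d) ⊗ term c d s i j))
        ≈⟨ +-cong (+-identityˡ _) (+-identityˡ _) ⟩
      partialTheta c d m s ⊕ antidiagonal m (λ i j → q^ (M * s + d) ⊗ term c d s i j)
        ≈⟨ +-cong (*-identityˡ _) (antidiagonal-⊗ _ m _) ⟨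
      one ⊗ partialTheta c d m s ⊕ q^ (M * s + d) ⊗ partialTheta c d m s
        ≈⟨ distribʳ _ _ _ ⟨
      1+q^ (M * s + d) ⊗ partialTheta c d m s  ∎
      where
      t α β : ℕ → ℕ → Series
      t = term c d (suc s)
      α i j = 1-q^ (M * i) ⊗ t i j
      β i j = q^ (M * i) ⊗ (1-q^ (M * j) ⊗ t i j)

      split : ∀ i j → i + j ≡ suc m → 1-q^ (M * suc m) ⊗ t i j ≈ α i j ⊕ β i j
      split i j i+j≡m = begin
        1-q^ (M * suc m) ⊗ t i j
          ≈⟨ *-congʳ (1-q^-+ (≡.trans (≡.sym (ℕ.*-distribˡ-+ M i j)) (cong (M *_) i+j≡m))) ⟩
        (1-q^ (M * i) ⊕ q^ (M * i) ⊗ 1-q^ (M * j)) ⊗ t i j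
          ≈⟨ distribʳ _ _ _ ⟩
        α i j ⊕ q^ (M * i) ⊗ 1-q^ (M * j) ⊗ t i j
          ≈⟨ +-congˡ (*-assoc _ _ _) ⟩
        α i j ⊕ β i j  ∎

      α-suc : ∀ i j → α (suc i) j ≈ term c d s i j
      α-suc i j = begin
        1-q^ (M * suc i) ⊗ (u (suc i) ⊗ u j ⊗ q^ _)     ≈⟨ *-assoc _ _ _ ⟨
        1-q^ (M * suc i) ⊗ (u (suc i) ⊗ u j) ⊗ q^ _     ≈⟨ *-congʳ (*-assoc _ _ _) ⟨
        1-q^ (M * suc i) ⊗ u (suc i) ⊗ u j ⊗ q^ _       ≈⟨ *-congʳ (*-congʳ (u-suc i)) ⟩
        u i ⊗ u j ⊗ q^ _                                ∎

      β-suc : ∀ i j → β i (suc j) ≈ q^ (M * s + d) ⊗ term c d s i j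
      β-suc i j = begin
        q^ (M * i) ⊗ (1-q^ (M * suc j) ⊗ (u i ⊗ u (suc j) ⊗ q^ e′))
          ≈⟨ *-congˡ (*-assoc _ _ _) ⟨
        q^ (M * i) ⊗ (1-q^ (M * suc j) ⊗ (u i ⊗ u (suc j)) ⊗ q^ e′)
          ≈⟨ *-congˡ (*-congʳ (trans (x⊗yz≈y⊗xz _ _ _) (*-congˡ (u-suc j)))) ⟩
        q^ (M * i) ⊗ (u i ⊗ u j ⊗ q^ e′)
          ≈⟨ x⊗yz≈y⊗xz _ _ _ ⟩
        u i ⊗ u j ⊗ (q^ (M * i) ⊗ q^ e′)
          ≈⟨ *-congˡ (trans (q^-+ (≡.sym (exponent-suc M c d c+d≡M i s))) (sym (q^-+ ≡.refl))) ⟩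
        u i ⊗ u j ⊗ (q^ (M * s + d) ⊗ q^ (exponent M c d i s))
          ≈⟨ x⊗yz≈y⊗xz _ _ _ ⟩
        q^ (M * s + d) ⊗ (u i ⊗ u j ⊗ q^ (exponent M c d i s))  ∎
        where e′ = exponent M c d i (suc s)

    partialTheta-flip : ∀ c d m → partialTheta d c m m ≈ partialTheta c d m 0
    partialTheta-flip c d m = begin
      antidiagonal m (term d c m)          ≈⟨ antidiagonal-cong m swap ⟩
      antidiagonal m (flip (term c d 0))   ≈⟨ antidiagonal-flip m (term c d 0) ⟩
      antidiagonal m (term c d 0)          ∎
      where
      swap : ∀ i j → i + j ≡ m → term d c m i j ≈ term c d 0 j i
      swap i j ≡.refl = ⊗-cong (*-comm (u i) (u j))
        (reflexive (cong q^ (≡.trans (exponent-+ M d c i j) (≡.sym (exponent-zero M c d j)))))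

    -- Each new factor 1 + q^(Ms+d) is absorbed by `partialTheta-step`, which raises the number of
    -- factors and the centre together.
    product-theta : ∀ c d → c + d ≡ M → ∀ r →
      ∏ r (λ i → 1+q^ (M * i + c)) ≈ partialProduct M r ⊗ partialTheta c d r 0 → ∀ s →
      ∏ s (λ i → 1+q^ (M * i + d)) ⊗ ∏ r (λ i → 1+q^ (M * i + c)) ≈
        partialProduct M (s + r) ⊗ partialTheta c d (s + r) s
    product-theta c d c+d≡M r base zero    = trans (*-identityˡ _) base
    product-theta c d c+d≡M r base (suc s) = begin
      1+q^ (M * s + d) ⊗ Π d s ⊗ Π c r
        ≈⟨ *-assoc _ _ _ ⟩
      1+q^ (M * s + d) ⊗ (Π d s ⊗ Π c r)
        ≈⟨ *-congˡ (product-theta c d c+d≡M r base s) ⟩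
      1+q^ (M * s + d) ⊗ (partialProduct M m ⊗ partialTheta c d m s)
        ≈⟨ x⊗yz≈y⊗xz _ _ _ ⟩
      partialProduct M m ⊗ (1+q^ (M * s + d) ⊗ partialTheta c d m s)
        ≈⟨ *-congˡ (partialTheta-step c d c+d≡M m s) ⟨
      partialProduct M m ⊗ (1-q^ (M * suc m) ⊗ partialTheta c d (suc m) (suc s))
        ≈⟨ x⊗yz≈y⊗xz _ _ _ ⟩
      1-q^ (M * suc m) ⊗ (partialProduct M m ⊗ partialTheta c d (suc m) (suc s))
        ≈⟨ *-assoc _ _ _ ⟨
      1-q^ (M * suc m) ⊗ partialProduct M m ⊗ partialTheta c d (suc m) (suc s)
        ≈⟨ *-congʳ (reflexive (partialProduct-suc M m)) ⟨
      partialProduct M (suc m) ⊗ partialTheta c d (suc m) (suc s)  ∎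
      where
      m = s + r
      Π : ℕ → ℕ → Series
      Π c r = ∏ r (λ i → 1+q^ (M * i + c))

    -- The base case s = 0 is the case r = 0 with the roles of c and d exchanged.
    finite-triple-product : ∀ c d → c + d ≡ M → ∀ r s →
      ∏ s (λ i → 1+q^ (M * i + d)) ⊗ ∏ r (λ i → 1+q^ (M * i + c)) ≈
        partialProduct M (s + r) ⊗ partialTheta c d (s + r) s
    finite-triple-product c d c+d≡M r = product-theta c d c+d≡M r (begin
      ∏ r (λ i → 1+q^ (M * i + c))
        ≈⟨ *-identityʳ _ ⟨
      ∏ r (λ i → 1+q^ (M * i + c)) ⊗ one
        ≈⟨ product-theta d c (≡.trans (ℕ.+-comm d c) c+d≡M) 0 base₀ r ⟩
      partialProduct M (r + 0) ⊗ partialTheta d c (r + 0) r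
        ≡⟨ cong (λ m → partialProduct M m ⊗ partialTheta d c m r) (ℕ.+-identityʳ r) ⟩
      partialProduct M r ⊗ partialTheta d c r r
        ≈⟨ *-congˡ (partialTheta-flip c d r) ⟩
      partialProduct M r ⊗ partialTheta c d r 0  ∎)
      where
      base₀ : one ≈ one ⊗ (u 0 ⊗ u 0 ⊗ one)
      base₀ = sym (trans (*-identityˡ _) (trans (*-identityʳ _)
        (trans (⊗-cong u₀ u₀) (*-identityˡ one))))
        where
        u₀ : u 0 ≈ one
        u₀ = trans (sym (*-identityˡ (u 0))) (pp-u 0)

    triple-product : ∀ c d .{{_ : NonZero c}} .{{_ : NonZero d}} → c + d ≡ M →
      ∀ {N} → L + L ℕ.≤ N →
      f M ⊗ (∏ N (λ i → 1+q^ (M * i + d)) ⊗ ∏ N (λ i → 1+q^ (M * i + c))) ≈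
        ∑ (N + N) (λ k → q^ (exponent M c d k N))
    triple-product c d c+d≡M {N} 2L≤N = begin
      f M ⊗ (∏ N (λ i → 1+q^ (M * i + d)) ⊗ ∏ N (λ i → 1+q^ (M * i + c)))
        ≈⟨ *-congˡ (finite-triple-product c d c+d≡M N N) ⟩
      f M ⊗ (partialProduct M (N + N) ⊗ partialTheta c d (N + N) N)
        ≈⟨ *-congˡ (⊗-cong (f-partialProduct M (ℕ.≤-trans L≤N (ℕ.m≤m+n N N)))
             (trans (antidiagonal-cong (N + N) uniform) (sym (antidiagonal-⊗ (U ⊗ U) (N + N) _)))) ⟩
      f M ⊗ (f M ⊗ (U ⊗ U ⊗ antidiagonal (N + N) (λ i _ → q^ (e i))))
        ≈⟨ *-assoc _ _ _ ⟨
      f M ⊗ f M ⊗ (U ⊗ U ⊗ antidiagonal (N + N) (λ i _ → q^ (e i)))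
        ≈⟨ *-assoc _ _ _ ⟨
      f M ⊗ f M ⊗ (U ⊗ U) ⊗ antidiagonal (N + N) (λ i _ → q^ (e i))
        ≈⟨ ⊗-cong (trans (⊗-interchange (f M) (f M) U U)
             (trans (⊗-cong (⊗-inverseʳ (f M) ≡.refl) (⊗-inverseʳ (f M) ≡.refl)) (*-identityˡ one)))
             (antidiagonal-∑ (N + N) (λ i → q^ (e i))) ⟩
      one ⊗ (q^ (e (N + N)) ⊕ ∑ (N + N) (λ i → q^ (e i)))
        ≈⟨ *-identityˡ _ ⟩
      q^ (e (N + N)) ⊕ ∑ (N + N) (λ i → q^ (e i))
        -- An antidiagonal has one term more than 2N. The top one has exponent at least N and is
        -- dropped, so that the number of terms is even and can later be split by parity.
        ≈⟨ +-congʳ (q^-vanishes (ℕ.≤-trans L≤N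
             (ℕ.+-cancelʳ-≤ N N _ (k≤exponent+s M c d (N + N) N)))) ⟩
      𝟘 ⊕ ∑ (N + N) (λ i → q^ (e i))
        ≈⟨ +-identityˡ _ ⟩
      ∑ (N + N) (λ i → q^ (e i))  ∎
      where
      U = inverse (f M)
      e : ℕ → ℕ
      e i = exponent M c d i N
      L≤N : L ℕ.≤ N
      L≤N = ℕ.≤-trans (ℕ.m≤m+n L L) 2L≤N

      u-limit : ∀ {k} → L ℕ.≤ k → u k ≈ U
      u-limit {k} L≤k =
        ⊗-inverse-cong (partialProduct-constantTerm M k) ≡.refl (f-partialProduct M L≤k)

      vanishing : ∀ s {i} → L ℕ.≤ e i → ∀ v → s ⊗ q^ (e i) ≈ v ⊗ q^ (e i)
      vanishing s {i} L≤e v = begin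
        s ⊗ q^ (e i)   ≈⟨ *-congˡ (q^-vanishes L≤e) ⟩
        s ⊗ 𝟘          ≈⟨ zeroʳ s ⟩
        𝟘              ≈⟨ zeroʳ v ⟨
        v ⊗ 𝟘          ≈⟨ *-congˡ (q^-vanishes L≤e) ⟨
        v ⊗ q^ (e i)   ∎

      -- If i and j are both at least L, then `u i` and `u j` have reached their limit. Otherwise
      -- the index is so far from the centre N that the exponent is at least N - L, hence at least
      -- L; this is why N must be at least 2L.
      uniform : ∀ i j → i + j ≡ N + N → term c d N i j ≈ U ⊗ U ⊗ q^ (e i)
      uniform i j i+j≡2N with ℕ.≤-<-connex L i | ℕ.≤-<-connex L j
      ... | inj₁ L≤i | inj₁ L≤j = *-congʳ (⊗-cong (u-limit L≤i) (u-limit L≤j))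
      ... | inj₂ i<L | _        = vanishing (u i ⊗ u j) {i}
        (ℕ.+-cancelʳ-≤ L L (e i) (ℕ.≤-trans 2L≤N
          (ℕ.≤-trans (s≤exponent+k M c d i N) (ℕ.+-monoʳ-≤ (e i) (ℕ.<⇒≤ i<L)))))
        (U ⊗ U)
      ... | _        | inj₂ j<L = vanishing (u i ⊗ u j) {i}
        (ℕ.+-cancelʳ-≤ L L (e i) (ℕ.≤-trans 2L≤N N≤e+L)) (U ⊗ U)
        where
        N≤e+L : N ℕ.≤ e i + L
        N≤e+L = ℕ.+-cancelʳ-≤ N N (e i + L) (ℕ.≤-trans (ℕ.≤-reflexive (≡.sym i+j≡2N))
          (ℕ.≤-trans (ℕ.+-mono-≤ (k≤exponent+s M c d i N) (ℕ.<⇒≤ j<L))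
            (ℕ.≤-reflexive (rearrange (e i)))))
          where
          rearrange : ∀ x → x + N + L ≡ x + L + N
          rearrange x = solve (x ∷ N ∷ L ∷ [])

-- The substitution q ↦ −q².
τ : Series → Series
τ s zero          = s 0
τ s (suc zero)    = 0ℤ
τ s (suc (suc n)) = ℤ.- τ (tail s) n

τ-0 : τ 𝟘 ≗ 𝟘
τ-0 zero          = ≡.refl
τ-0 (suc zero)    = ≡.refl
τ-0 (suc (suc n)) = cong ℤ.-_ (τ-0 n)

τ-one : τ one ≗ one
τ-one zero          = ≡.refl
τ-one (suc zero)    = ≡.refl
τ-one (suc (suc n)) = cong ℤ.-_ (τ-0 n)

τ-· : ∀ c s → τ (c · s) ≗ c · τ s
τ-· c s zero          = ≡.refl
τ-· c s (suc zero)    = ≡.sym (ℤ.*-zeroʳ c)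
τ-· c s (suc (suc n)) = ≡.trans (cong ℤ.-_ (τ-· c (tail s) n)) (ℤ.neg-distribʳ-* c (τ (tail s) n))

τ-q^-even : ∀ k → τ (q^ (k * 2)) ≗ q^ (k * 4)
τ-q^-even zero    n                   = τ-one n
τ-q^-even (suc k) 0                   = ≡.refl
τ-q^-even (suc k) 1                   = ≡.refl
τ-q^-even (suc k) 2                   = ≡.refl
τ-q^-even (suc k) 3                   = ≡.refl
τ-q^-even (suc k) (suc (suc (suc (suc n)))) =
  ≡.trans (ℤ.neg-involutive _) (τ-q^-even k n)

opaque
  unfolding _⊕_

  τ-⊕ : ∀ s u → τ (s ⊕ u) ≗ τ s ⊕ τ u
  τ-⊕ s u zero          = ≡.refl
  τ-⊕ s u (suc zero)    = ≡.refl
  τ-⊕ s u (suc (suc n)) = ≡.trans (cong ℤ.-_ (τ-⊕ (tail s) (tail u) n))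
    (ℤ.neg-distrib-+ (τ (tail s) n) (τ (tail u) n))

  τ-⊖ : ∀ s → τ (⊖ s) ≗ ⊖ τ s
  τ-⊖ s zero          = ≡.refl
  τ-⊖ s (suc zero)    = ≡.refl
  τ-⊖ s (suc (suc n)) = cong ℤ.-_ (τ-⊖ (tail s) n)

  τ-q^-odd : ∀ k → τ (q^ (1 + k * 2)) ≗ ⊖ q^ (2 + k * 4)
  τ-q^-odd k 0             = ≡.refl
  τ-q^-odd k 1             = ≡.refl
  τ-q^-odd k (suc (suc n)) = cong ℤ.-_ (τ-q^-even k n)

  -- The recursion says τ s = s 0 - q² τ (`tail s`), so multiplicativity follows by induction from
  -- the recursion for the tail of a product.
  τ-⊗ : ∀ s u → τ (s ⊗ u) ≗ τ s ⊗ τ u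
  τ-⊗ s u zero          = ≡.refl
  τ-⊗ s u (suc zero)    = begin
    0ℤ                                             ≡⟨⟩
    0ℤ ℤ.+ 0ℤ                                      ≡⟨ cong (ℤ._+ 0ℤ) (ℤ.*-zeroʳ (s 0)) ⟨
    s 0 ℤ.* 0ℤ ℤ.+ 0ℤ ∎
    where open ≡.≡-Reasoning
  τ-⊗ s u (suc (suc n)) = begin
    ℤ.- τ (s 0 · tail u ⊕ tail s ⊗ u) n
      ≡⟨ cong ℤ.-_ (τ-⊕ (s 0 · tail u) (tail s ⊗ u) n) ⟩
    ℤ.- (τ (s 0 · tail u) n ℤ.+ τ (tail s ⊗ u) n)
      ≡⟨ cong ℤ.-_ (cong₂ ℤ._+_ (τ-· (s 0) (tail u) n) (τ-⊗ (tail s) u n)) ⟩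
    ℤ.- (s 0 ℤ.* τ (tail u) n ℤ.+ (τ (tail s) ⊛ τ u) n)
      ≡⟨ ℤ.neg-distrib-+ (s 0 ℤ.* τ (tail u) n) _ ⟩
    ℤ.- (s 0 ℤ.* τ (tail u) n) ℤ.+ ℤ.- (τ (tail s) ⊛ τ u) n
      ≡⟨ cong₂ ℤ._+_ (ℤ.neg-distribʳ-* (s 0) (τ (tail u) n))
           (≡.trans (≡.sym (⊖-⊛ n)) (≡.sym (ℤ.+-identityˡ _))) ⟩
    s 0 ℤ.* τ u (suc (suc n)) ℤ.+ (0ℤ ℤ.+ (tail (tail (τ s)) ⊛ τ u) n)  ∎
    where
    open ≡.≡-Reasoning
    ⊖-⊛ : ∀ n → ((λ m → ℤ.- τ (tail s) m) ⊛ τ u) n ≡ ℤ.- (τ (tail s) ⊛ τ u) n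
    ⊖-⊛ n = begin
      ((λ m → ℤ.- τ (tail s) m) ⊛ τ u) n
        ≡⟨ ⊛-cong-≤ {u = τ u} n (λ {m} _ → ≡.sym (ℤ.-1*i≡-i (τ (tail s) m))) (λ _ → ≡.refl) ⟩
      ((ℤ.-1ℤ · τ (tail s)) ⊛ τ u) n
        ≡⟨ ·-⊛ ℤ.-1ℤ (τ (tail s)) (τ u) n ⟩
      ℤ.-1ℤ ℤ.* (τ (tail s) ⊛ τ u) n
        ≡⟨ ℤ.-1*i≡-i _ ⟩
      ℤ.- (τ (tail s) ⊛ τ u) n  ∎

opaque
  unfolding _⊕_

  q^1⊗-suc : ∀ u n → (q^ 1 ⊗ u) (suc n) ≡ u n
  q^1⊗-suc u n = ≡.trans (ℤ.+-identityˡ _) (⊛-identityˡ u n)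

  -- The coefficient of q^(2k) in `τ s` is (-1)^k `s k`, and odd degrees are empty; multiplication
  -- by q moves `τ u` into exactly these.
  τ-mod-4 : ∀ s u n → let v = τ s ⊕ q^ 1 ⊗ τ u in
    v (4 * n) ≡ s (2 * n) × v (4 * n + 1) ≡ u (2 * n) ×
    v (4 * n + 2) ≡ ℤ.- s (2 * n + 1) × v (4 * n + 3) ≡ ℤ.- u (2 * n + 1)
  τ-mod-4 s u n
    rewrite ℕ.*-comm 4 n | ℕ.*-comm 2 n | ℕ.+-comm (n * 4) 1 | ℕ.+-comm (n * 4) 2
          | ℕ.+-comm (n * 4) 3 | ℕ.+-comm (n * 2) 1 =
      even₀ n
    , ≡.trans (cong₂ ℤ._+_ (τ-odd s n) (q^1⊗-suc (τ u) (n * 4)))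
        (≡.trans (ℤ.+-identityˡ _) (τ-4n u n))
    , ≡.trans (cong₂ ℤ._+_ (cong ℤ.-_ (τ-4n (tail s) n))
        (≡.trans (q^1⊗-suc (τ u) (1 + n * 4)) (τ-odd u n))) (ℤ.+-identityʳ _)
    , ≡.trans (cong₂ ℤ._+_ (cong ℤ.-_ (τ-odd (tail s) n))
        (≡.trans (q^1⊗-suc (τ u) (2 + n * 4)) (cong ℤ.-_ (τ-4n (tail u) n)))) (ℤ.+-identityˡ _)
    where
    τ-4n : ∀ s n → τ s (n * 4) ≡ s (n * 2)
    τ-4n s zero    = ≡.refl
    τ-4n s (suc n) = ≡.trans (ℤ.neg-involutive _) (τ-4n (tail (tail s)) n)
    τ-odd : ∀ s n → τ s (1 + n * 4) ≡ 0ℤ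
    τ-odd s zero    = ≡.refl
    τ-odd s (suc n) = ≡.trans (ℤ.neg-involutive _) (τ-odd (tail (tail s)) n)
    even₀ : ∀ n → (τ s ⊕ q^ 1 ⊗ τ u) (n * 4) ≡ s (n * 2)
    even₀ zero    = ℤ.+-identityʳ _
    even₀ (suc n) = ≡.trans (cong₂ ℤ._+_ (τ-4n s (suc n))
      (≡.trans (q^1⊗-suc (τ u) (3 + n * 4)) (cong ℤ.-_ (τ-odd (tail u) n))))
      (ℤ.+-identityʳ _)

-- Positivity

*-nonneg : ∀ {i j} → 0ℤ ℤ.≤ i → 0ℤ ℤ.≤ j → 0ℤ ℤ.≤ i ℤ.* j
*-nonneg {i} {j} 0≤i 0≤j = ℤ.*-monoʳ-≤-nonNeg j {{ℤ.nonNegative 0≤j}} 0≤i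

*-pos : ∀ {i j} → 0ℤ ℤ.< i → 0ℤ ℤ.< j → 0ℤ ℤ.< i ℤ.* j
*-pos {i} {j} 0<i 0<j = ℤ.*-monoʳ-<-pos j {{ℤ.positive 0<j}} 0<i

⊛-nonneg : ∀ {s u} n → (∀ {m} → m ℕ.≤ n → 0ℤ ℤ.≤ s m) → (∀ {m} → m ℕ.≤ n → 0ℤ ℤ.≤ u m) →
  0ℤ ℤ.≤ (s ⊛ u) n
⊛-nonneg zero    0≤s 0≤u = ℤ.+-mono-≤ (*-nonneg (0≤s ℕ.z≤n) (0≤u ℕ.z≤n)) ℤ.≤-refl
⊛-nonneg (suc n) 0≤s 0≤u = ℤ.+-mono-≤ (*-nonneg (0≤s ℕ.z≤n) (0≤u ℕ.≤-refl))
  (⊛-nonneg n (0≤s ∘ ℕ.s≤s) (0≤u ∘ ℕ.m≤n⇒m≤1+n))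

⊛-pos : ∀ {s u} i j → (∀ {m} → m ℕ.≤ i + j → 0ℤ ℤ.≤ s m) → (∀ {m} → m ℕ.≤ i + j → 0ℤ ℤ.≤ u m) →
  0ℤ ℤ.< s i → 0ℤ ℤ.< u j → 0ℤ ℤ.< (s ⊛ u) (i + j)
⊛-pos zero    zero    0≤s 0≤u 0<s 0<u = ℤ.+-mono-<-≤ (*-pos 0<s 0<u) ℤ.≤-refl
⊛-pos zero    (suc j) 0≤s 0≤u 0<s 0<u = ℤ.+-mono-<-≤ (*-pos 0<s 0<u)
  (⊛-nonneg j (0≤s ∘ ℕ.s≤s) (0≤u ∘ ℕ.m≤n⇒m≤1+n))
⊛-pos (suc i) j       0≤s 0≤u 0<s 0<u = ℤ.+-mono-≤-< (*-nonneg (0≤s ℕ.z≤n) (0≤u ℕ.≤-refl))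
  (⊛-pos i j (0≤s ∘ ℕ.s≤s) (0≤u ∘ ℕ.m≤n⇒m≤1+n) 0<s 0<u)

q^-nonneg : ∀ d n → 0ℤ ℤ.≤ q^ d n
q^-nonneg zero    zero    = ℤ.+≤+ ℕ.z≤n
q^-nonneg zero    (suc n) = ℤ.≤-refl
q^-nonneg (suc d) zero    = ℤ.≤-refl
q^-nonneg (suc d) (suc n) = q^-nonneg d n

q^-diagonal : ∀ d → q^ d d ≡ 1ℤ
q^-diagonal zero    = ≡.refl
q^-diagonal (suc d) = q^-diagonal d

opaque
  unfolding _⊕_

  1+q^-constantTerm : ∀ d .{{_ : NonZero d}} → 1+q^ d 0 ≡ 1ℤ
  1+q^-constantTerm (suc d) = ≡.refl

  1+q^-pos : ∀ d → 0ℤ ℤ.< 1+q^ d 0 × 0ℤ ℤ.< 1+q^ d d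
  1+q^-pos d =
    ℤ.+-mono-<-≤ {0ℤ} (ℤ.+<+ (ℕ.s≤s ℕ.z≤n)) (q^-nonneg d 0) ,
    ℤ.+-mono-≤-< {0ℤ} (q^-nonneg 0 d)
      (≡.subst (0ℤ ℤ.<_) (≡.sym (q^-diagonal d)) (ℤ.+<+ (ℕ.s≤s ℕ.z≤n)))

  1+q^+q^-constantTerm : ∀ d .{{_ : NonZero d}} → (one ⊕ (q^ d ⊕ q^ (2 * d))) 0 ≡ 1ℤ
  1+q^+q^-constantTerm (suc d) = ≡.refl

module Positivity (L : ℕ) where
  open Products L
  open TripleProduct L using (1-q^-⊗)

  NonNeg : Series → Set
  NonNeg s = ∀ {n} → n ℕ.< L → 0ℤ ℤ.≤ s n

  Positive : Series → Set
  Positive s = ∀ {n} → n ℕ.< L → 0ℤ ℤ.< s n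

  nonNeg-≈ : ∀ {s u} → s ≈ u → NonNeg s → NonNeg u
  nonNeg-≈ s≈u 0≤s n<L = ≡.subst (0ℤ ℤ.≤_) (coeff s≈u n<L) (0≤s n<L)

  nonNeg-q^ : ∀ d → NonNeg (q^ d)
  nonNeg-q^ d {n} _ = q^-nonneg d n

  opaque
    unfolding _⊕_

    nonNeg-⊕ : ∀ {s u} → NonNeg s → NonNeg u → NonNeg (s ⊕ u)
    nonNeg-⊕ 0≤s 0≤u n<L = ℤ.+-mono-≤ (0≤s n<L) (0≤u n<L)

    nonNeg-⊗ : ∀ {s u} → NonNeg s → NonNeg u → NonNeg (s ⊗ u)
    nonNeg-⊗ 0≤s 0≤u {n} n<L = ⊛-nonneg n
      (λ m≤n → 0≤s (ℕ.≤-<-trans m≤n n<L)) (λ m≤n → 0≤u (ℕ.≤-<-trans m≤n n<L))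

    ⊗-pos : ∀ {s u} → NonNeg s → NonNeg u → ∀ i j → i + j ℕ.< L →
      0ℤ ℤ.< s i → 0ℤ ℤ.< u j → 0ℤ ℤ.< (s ⊗ u) (i + j)
    ⊗-pos 0≤s 0≤u i j i+j<L = ⊛-pos i j
      (λ m≤ → 0≤s (ℕ.≤-<-trans m≤ i+j<L)) (λ m≤ → 0≤u (ℕ.≤-<-trans m≤ i+j<L))

    -- Since s = (1 - q^d) s + q^d s, each coefficient of s is a nonnegative number plus zero or an
    -- earlier coefficient of s. Iterated, this makes reciprocals of products of 1 - q^d
    -- nonnegative.
    nonNeg-cancel-1-q^ : ∀ d .{{_ : NonZero d}} {s} → NonNeg (1-q^ d ⊗ s) → NonNeg s
    nonNeg-cancel-1-q^ (suc d) {s} 0≤[1-q^]s {n} = <-rec _ step n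
      where
      step : ∀ n → (∀ {m} → m ℕ.< n → m ℕ.< L → 0ℤ ℤ.≤ s m) → n ℕ.< L → 0ℤ ℤ.≤ s n
      step n 0≤s n<L = ≡.subst (λ i → 0ℤ ℤ.≤ i) (begin
        (1-q^ (suc d) ⊗ s) n ℤ.+ (q^ (suc d) ⊗ s) n
          ≡⟨ cong (ℤ._+ (q^ (suc d) ⊗ s) n) (coeff (1-q^-⊗ (suc d) s) n<L) ⟩
        s n ℤ.+ ℤ.- (q^ (suc d) ⊗ s) n ℤ.+ (q^ (suc d) ⊗ s) n
          ≡⟨ ℤ.+-assoc (s n) _ _ ⟩
        s n ℤ.+ (ℤ.- (q^ (suc d) ⊗ s) n ℤ.+ (q^ (suc d) ⊗ s) n)
          ≡⟨ cong (ℤ._+_ (s n)) (ℤ.+-inverseˡ ((q^ (suc d) ⊗ s) n)) ⟩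
        s n ℤ.+ 0ℤ
          ≡⟨ ℤ.+-identityʳ (s n) ⟩
        s n  ∎) (ℤ.+-mono-≤ (0≤[1-q^]s n<L) (shift n 0≤s n<L))
        where
        open ≡.≡-Reasoning
        shift : ∀ n → (∀ {m} → m ℕ.< n → m ℕ.< L → 0ℤ ℤ.≤ s m) → n ℕ.< L →
          0ℤ ℤ.≤ (q^ (suc d) ⊗ s) n
        shift zero    _   _   = ℤ.≤-refl
        shift (suc n) 0≤s n<L = ℤ.+-mono-≤ {0ℤ} (ℤ.≤-refl {0ℤ}) (⊛-nonneg {q^ d} {s} n
          (λ {m} _ → q^-nonneg d m)
          (λ m≤n → 0≤s (ℕ.s≤s m≤n) (ℕ.≤-<-trans (ℕ.m≤n⇒m≤1+n m≤n) n<L)))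

  nonNeg-∏ : ∀ K {h} → (∀ i → NonNeg (h i)) → NonNeg (∏ K h)
  nonNeg-∏ zero    0≤h = nonNeg-q^ 0
  nonNeg-∏ (suc K) 0≤h = nonNeg-⊗ (0≤h K) (nonNeg-∏ K 0≤h)

  nonNeg-∑ : ∀ K {h} → (∀ i → NonNeg (h i)) → NonNeg (∑ K h)
  nonNeg-∑ zero    0≤h = λ _ → ℤ.≤-refl
  nonNeg-∑ (suc K) 0≤h = nonNeg-⊕ (0≤h K) (nonNeg-∑ K 0≤h)

  nonNeg-cancel-∏ : ∀ K (e : ℕ → ℕ) → (∀ i → NonZero (e i)) → ∀ {s} →
    NonNeg (∏ K (λ i → 1-q^ (e i)) ⊗ s) → NonNeg s
  nonNeg-cancel-∏ zero    e e≢0 0≤s = nonNeg-≈ (*-identityˡ _) 0≤s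
  nonNeg-cancel-∏ (suc K) e e≢0 0≤s = nonNeg-cancel-∏ K e e≢0
    (nonNeg-cancel-1-q^ (e K) {{e≢0 K}} (nonNeg-≈ (*-assoc _ _ _) 0≤s))

  -- Choosing q^(e i) from factor i and 1 from all others contributes to this coefficient, and
  -- nothing contributes negatively.
  ∏-1+q^-pos : ∀ K (e : ℕ → ℕ) → (∀ i → NonZero (e i)) → ∀ {i} → i ℕ.< K → e i ℕ.< L →
    0ℤ ℤ.< ∏ K (λ i → 1+q^ (e i)) (e i)
  ∏-1+q^-pos (suc K) e e≢0 {i} i<1+K ei<L with ℕ.m≤n⇒m<n∨m≡n (ℕ.s≤s⁻¹ i<1+K)
  ... | inj₁ i<K    = ⊗-pos (0≤1+q^ K) (nonNeg-∏ K 0≤1+q^) 0 (e i) ei<L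
    (proj₁ (1+q^-pos (e K))) (∏-1+q^-pos K e e≢0 i<K ei<L)
    where
    0≤1+q^ : ∀ i → NonNeg (1+q^ (e i))
    0≤1+q^ i = nonNeg-⊕ (nonNeg-q^ 0) (nonNeg-q^ (e i))
  ... | inj₂ ≡.refl = ≡.subst (λ n → 0ℤ ℤ.< ∏ (suc i) (λ i → 1+q^ (e i)) n) (ℕ.+-identityʳ (e i))
    (⊗-pos (0≤1+q^ i) (nonNeg-∏ i 0≤1+q^) (e i) 0
      (≡.subst (ℕ._< L) (≡.sym (ℕ.+-identityʳ (e i))) ei<L)
      (proj₂ (1+q^-pos (e i)))
      (≡.subst (0ℤ ℤ.<_) (≡.sym (∏-constantTerm i λ i → 1+q^-constantTerm (e i) {{e≢0 i}}))
        (ℤ.+<+ (ℕ.s≤s ℕ.z≤n))))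
    where
    0≤1+q^ : ∀ i → NonNeg (1+q^ (e i))
    0≤1+q^ i = nonNeg-⊕ (nonNeg-q^ 0) (nonNeg-q^ (e i))

+-nonZeroʳ : ∀ m n .{{_ : NonZero n}} → NonZero (m + n)
+-nonZeroʳ m n = ℕ.>-nonZero (ℕ.≤-trans (ℕ.>-nonZero⁻¹ n) (ℕ.m≤n+m n m))

1+q^+q^ : ℕ → Series
1+q^+q^ d = one ⊕ (q^ d ⊕ q^ (2 * d))

-- Eta quotients

fs : List ℕ → Series
fs []       = one
fs (j ∷ js) = f j ⊗ fs js

fs-constantTerm : ∀ js → fs js 0 ≡ 1ℤ
fs-constantTerm []       = ≡.refl
fs-constantTerm (j ∷ js) = ⊗-constantTerm {f j} ≡.refl (fs-constantTerm js)

-- τ f_j is f_{2j} for even j and f_{4j}³ / (f_{2j} f_{8j}) for odd j.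
τ-numerator τ-denominator : ℕ → List ℕ
τ-numerator j with ℕ.parity j
... | 0ℙ = 2 * j ∷ []
... | 1ℙ = 2 * (2 * j) ∷ 2 * (2 * j) ∷ 2 * (2 * j) ∷ []
τ-denominator j with ℕ.parity j
... | 0ℙ = []
... | 1ℙ = 2 * (2 * (2 * j)) ∷ 2 * j ∷ []

parity-even : ∀ k → ℕ.parity (k * 2) ≡ 0ℙ
parity-even zero    = ≡.refl
parity-even (suc k) = parity-even k

parity-odd : ∀ k → ℕ.parity (1 + k * 2) ≡ 1ℙ
parity-odd zero    = ≡.refl
parity-odd (suc k) = parity-odd k

data EvenOrOdd : ℕ → Set where
  even : ∀ k → EvenOrOdd (k * 2)
  odd  : ∀ k → EvenOrOdd (1 + k * 2)

evenOrOdd : ∀ n → EvenOrOdd n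
evenOrOdd zero       = even 0
evenOrOdd (suc zero) = odd 0
evenOrOdd (suc (suc n)) with evenOrOdd n
... | even k = even (suc k)
... | odd k  = odd (suc k)

opaque
  unfolding _⊗_

  ^ℕ-suc : ∀ s k → s ^ℕ suc k ≡ s ⊗ s ^ℕ k
  ^ℕ-suc s k = ≡.refl

  a-⊗ : ∀ t₁ t₂ t₃ t₄ → a (t₁ Vec.∷ t₂ Vec.∷ t₃ Vec.∷ t₄ Vec.∷ Vec.[]) ≡
    f 1 ^ℤ t₁ ⊗ (f 2 ^ℤ t₂ ⊗ (f 3 ^ℤ t₃ ⊗ (f 4 ^ℤ t₄ ⊗ one)))
  a-⊗ t₁ t₂ t₃ t₄ = ≡.refl

  f₂²/f₁-coefficient : (f 2 ⊗ (f 2 ⊗ inverse (f 1))) 1 ≡ 1ℤ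
  f₂²/f₁-coefficient = ≡.refl

module Eta (L : ℕ) where
  open Products L
  open TripleProduct L
  open Positivity L
  open import Relation.Binary.Reasoning.Setoid setoid

  progression : (ℕ → Series) → ℕ → ℕ → Series
  progression h M c = ∏ L (λ i → h (M * i + c))

  -- Modulo q^L these are (q^c; q^M)_∞, (-q^c; q^M)_∞ and, for c > 0, (q^(3c); q^(3M))_∞ / (q^c;
  -- q^M)_∞.
  Π⁻ Π⁺ Πᵗ : ℕ → ℕ → Series
  Π⁻ = progression 1-q^
  Π⁺ = progression 1+q^
  Πᵗ = progression 1+q^+q^

  progression-constantTerm : ∀ {h} → (∀ d .{{_ : NonZero d}} → h d 0 ≡ 1ℤ) →
    ∀ M c .{{_ : NonZero c}} → progression h M c 0 ≡ 1ℤ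
  progression-constantTerm h₀ M c = ∏-constantTerm L λ i → h₀ (M * i + c) {{+-nonZeroʳ (M * i) c}}

  -- With k = 2 and k = 3 this turns `Π⁺` and `Πᵗ` into ratios of two `Π⁻`, and so into eta
  -- quotients.
  progression-* : ∀ {h} k → (∀ d → h d ⊗ 1-q^ d ≈ 1-q^ (k * d)) → ∀ M c →
    progression h M c ⊗ Π⁻ M c ≈ Π⁻ (k * M) (k * c)
  progression-* {h} k h1-q^ M c = begin
    progression h M c ⊗ Π⁻ M c            ≈⟨ ∏-⊗ L (λ i → h (M * i + c)) (λ i → 1-q^ (M * i + c)) ⟨
    ∏ L (λ i → h (M * i + c) ⊗ 1-q^ (M * i + c))
      ≈⟨ ∏-cong L (λ {i} _ → trans (h1-q^ (M * i + c)) (reflexive (cong 1-q^ (lemma i)))) ⟩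
    Π⁻ (k * M) (k * c)                                ∎
    where
    lemma : ∀ i → k * (M * i + c) ≡ k * M * i + k * c
    lemma i = solve (k ∷ M ∷ i ∷ c ∷ [])

  1+q^⊗1-q^ : ∀ d → 1+q^ d ⊗ 1-q^ d ≈ 1-q^ (2 * d)
  1+q^⊗1-q^ d = begin
    1+q^ d ⊗ 1-q^ d                                  ≈⟨ *-comm _ _ ⟩
    1-q^ d ⊗ (one ⊕ q^ d)                            ≈⟨ distribˡ _ _ _ ⟩
    1-q^ d ⊗ one ⊕ 1-q^ d ⊗ q^ d                     ≈⟨ +-cong (*-identityʳ _) (*-comm _ _) ⟩
    1-q^ d ⊕ q^ d ⊗ 1-q^ d
      ≈⟨ 1-q^-+ {d} {d} (cong (d +_) (≡.sym (ℕ.+-identityʳ d))) ⟨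
    1-q^ (2 * d)                                     ∎

  1+q^+q^⊗1-q^ : ∀ d → 1+q^+q^ d ⊗ 1-q^ d ≈ 1-q^ (3 * d)
  1+q^+q^⊗1-q^ d = begin
    1+q^+q^ d ⊗ 1-q^ d                               ≈⟨ *-comm _ _ ⟩
    1-q^ d ⊗ (one ⊕ (q^ d ⊕ q^ (2 * d)))             ≈⟨ distribˡ _ _ _ ⟩
    1-q^ d ⊗ one ⊕ 1-q^ d ⊗ (q^ d ⊕ q^ (2 * d))      ≈⟨ +-cong (*-identityʳ _) (*-congˡ (sym (begin
      q^ d ⊗ 1+q^ d                                    ≈⟨ distribˡ _ _ _ ⟩
      q^ d ⊗ one ⊕ q^ d ⊗ q^ d
        ≈⟨ +-cong (*-identityʳ _) (q^-+ {d} {d} (cong (d +_) (≡.sym (ℕ.+-identityʳ d)))) ⟩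
      q^ d ⊕ q^ (2 * d)                                ∎))) ⟩
    1-q^ d ⊕ 1-q^ d ⊗ (q^ d ⊗ 1+q^ d)
      ≈⟨ +-congˡ (trans (x⊗yz≈y⊗xz _ _ _) (*-congˡ (*-comm _ _))) ⟩
    1-q^ d ⊕ q^ d ⊗ (1+q^ d ⊗ 1-q^ d)                ≈⟨ +-congˡ (*-congˡ (1+q^⊗1-q^ d)) ⟩
    1-q^ d ⊕ q^ d ⊗ 1-q^ (2 * d)                     ≈⟨ 1-q^-+ {d} {2 * d} ≡.refl ⟨
    1-q^ (3 * d)                                     ∎

  1-q^-trivial : ∀ {d} → L ℕ.≤ d → 1-q^ d ≈ one
  1-q^-trivial {d} L≤d = begin
    1-q^ d         ≈⟨ 1-q^-def d ⟩
    one ⊕ ⊖ q^ d   ≈⟨ +-congˡ (trans (-‿cong (q^-vanishes L≤d)) -0#≈0#) ⟩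
    one ⊕ 𝟘        ≈⟨ +-identityʳ one ⟩
    one            ∎

  1+q^-trivial : ∀ {d} → L ℕ.≤ d → 1+q^ d ≈ one
  1+q^-trivial L≤d = trans (+-congˡ (q^-vanishes L≤d)) (+-identityʳ one)

  progression-split : ∀ {h} → (∀ {d} → L ℕ.≤ d → h d ≈ one) →
    ∀ k .{{_ : NonZero k}} M .{{_ : NonZero M}} c →
    progression h M c ≈ ∏ k (λ r → progression h (k * M) (M * r + c))
  progression-split {h} trivial k M c = begin
    ∏ L (λ i → h (M * i + c))
      -- Lengthening the product to `L * k` factors changes nothing modulo q^L and leaves L factors
      -- for each residue class.
      ≈⟨ ∏-stable (λ i → h (M * i + c)) (ℕ.m≤m*n L k) (λ {i} L≤i →
           trivial (ℕ.≤-trans L≤i (ℕ.≤-trans (ℕ.m≤n*m i M) (ℕ.m≤m+n (M * i) c)))) ⟨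
    ∏ (L * k) (λ i → h (M * i + c))
      ≈⟨ ∏-* L k (λ i → h (M * i + c)) ⟩
    ∏ k (λ r → ∏ L (λ i → h (M * (r + i * k) + c)))
      ≈⟨ ∏-cong k (λ {r} _ → ∏-cong L (λ {i} _ → reflexive (cong h (lemma r i)))) ⟩
    ∏ k (λ r → progression h (k * M) (M * r + c))  ∎
    where
    lemma : ∀ r i → M * (r + i * k) + c ≡ k * M * i + (M * r + c)
    lemma r i = solve (k ∷ M ∷ i ∷ c ∷ r ∷ [])

  Π⁻-f : ∀ j .{{_ : NonZero j}} → Π⁻ j j ≈ f j
  Π⁻-f j = begin
    ∏ L (λ i → 1-q^ (j * i + j))
      ≈⟨ ∏-cong L (λ {i} _ → reflexive (cong 1-q^
           (≡.trans (ℕ.+-comm (j * i) j) (≡.sym (ℕ.*-suc j i))))) ⟩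
    ∏ L (λ i → 1-q^ (j * suc i))     ≡⟨ partialProduct-∏ j L ⟨
    partialProduct j L               ≈⟨ f-partialProduct j ℕ.≤-refl ⟩
    f j                              ∎

  fs-++ : ∀ m n → fs (m ++ n) ≈ fs m ⊗ fs n
  fs-++ []      n = sym (*-identityˡ (fs n))
  fs-++ (j ∷ m) n = trans (*-congˡ (fs-++ m n)) (sym (*-assoc _ _ _))

  fs-↭ : ∀ {m n} → m ↭ n → fs m ≈ fs n
  fs-↭ Perm.refl         = refl
  fs-↭ (Perm.prep j p)   = *-congˡ (fs-↭ p)
  fs-↭ (Perm.swap j k p) = trans (x⊗yz≈y⊗xz _ _ _) (*-congˡ (*-congˡ (fs-↭ p)))
  fs-↭ (Perm.trans p r)  = trans (fs-↭ p) (fs-↭ r)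

  infix 4 _≋_÷_

  -- s is the eta quotient ∏_{j ∈ n} f_j / ∏_{j ∈ d} f_j.
  record _≋_÷_ (s : Series) (n d : List ℕ) : Set where
    constructor quotient
    field
      equation : s ⊗ fs d ≈ fs n

  open _≋_÷_

  ≋-cong : ∀ {s u n d} → s ≈ u → s ≋ n ÷ d → u ≋ n ÷ d
  ≋-cong s≈u s≋ = quotient (trans (*-congʳ (sym s≈u)) (equation s≋))

  ≋-⊗ : ∀ {s u n d n′ d′} → s ≋ n ÷ d → u ≋ n′ ÷ d′ → s ⊗ u ≋ n ++ n′ ÷ d ++ d′
  ≋-⊗ {s} {u} {n} {d} {n′} {d′} s≋ u≋ = quotient (begin
    s ⊗ u ⊗ fs (d ++ d′)          ≈⟨ *-congˡ (fs-++ d d′) ⟩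
    s ⊗ u ⊗ (fs d ⊗ fs d′)        ≈⟨ ⊗-interchange _ _ _ _ ⟩
    s ⊗ fs d ⊗ (u ⊗ fs d′)        ≈⟨ ⊗-cong (equation s≋) (equation u≋) ⟩
    fs n ⊗ fs n′                  ≈⟨ fs-++ n n′ ⟨
    fs (n ++ n′)                  ∎)

  ≋-/ : ∀ {s u n d n′ d′} → s ⊗ u ≋ n ÷ d → u ≋ n′ ÷ d′ → s ≋ n ++ d′ ÷ d ++ n′
  ≋-/ {s} {u} {n} {d} {n′} {d′} su≋ u≋ = quotient (begin
    s ⊗ fs (d ++ n′)                 ≈⟨ *-congˡ (trans (fs-++ d n′) (*-congˡ (sym (equation u≋)))) ⟩
    s ⊗ (fs d ⊗ (u ⊗ fs d′))
      ≈⟨ solve-⊗ 4 (λ s u d d′ → s ⊙ (d ⊙ (u ⊙ d′)) ⊜ ((s ⊙ u) ⊙ d) ⊙ d′) refl s u (fs d) (fs d′) ⟩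
    s ⊗ u ⊗ fs d ⊗ fs d′             ≈⟨ *-congʳ (equation su≋) ⟩
    fs n ⊗ fs d′                     ≈⟨ fs-++ n d′ ⟨
    fs (n ++ d′)                     ∎)

  ≋-f : ∀ j → f j ≋ j ∷ [] ÷ []
  ≋-f j = quotient refl

  ≋-one : one ≋ [] ÷ []
  ≋-one = quotient (*-identityʳ one)

  ≋-inverse : ∀ {s n d} → s 0 ≡ 1ℤ → s ≋ n ÷ d → inverse s ≋ d ÷ n
  ≋-inverse {s} s₀ s≋ = ≋-/ (≋-cong (sym (trans (*-comm _ _) (⊗-inverseʳ s s₀))) ≋-one) s≋

  -- Cross-multiplication: `n ++ d′` and `n′ ++ d` are permutations of each other when their sorted
  -- forms agree, which holds by evaluation for concrete lists; `fs d` cancels because its constant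
  -- term is 1.
  ≋-reduce : ∀ {s n d n′ d′} → s ≋ n ÷ d → sort (n ++ d′) ≡ sort (n′ ++ d) → s ≋ n′ ÷ d′
  ≋-reduce {s} {n} {d} {n′} {d′} s≋ sorted = quotient (⊗-cancelˡ (fs d) (fs-constantTerm d) (begin
    fs d ⊗ (s ⊗ fs d′)
      ≈⟨ solve-⊗ 3 (λ s d d′ → d ⊙ (s ⊙ d′) ⊜ (s ⊙ d) ⊙ d′) refl s (fs d) (fs d′) ⟩
    s ⊗ fs d ⊗ fs d′          ≈⟨ *-congʳ (equation s≋) ⟩
    fs n ⊗ fs d′              ≈⟨ fs-++ n d′ ⟨
    fs (n ++ d′)              ≈⟨ fs-↭ (↭-trans (↭-sym (sort-↭ (n ++ d′)))
      (↭-trans (↭-reflexive sorted) (sort-↭ (n′ ++ d)))) ⟩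
    fs (n′ ++ d)              ≈⟨ fs-++ n′ d ⟩
    fs n′ ⊗ fs d              ≈⟨ *-comm _ _ ⟩
    fs d ⊗ fs n′              ∎))

  ≋-unique : ∀ {s u n d n′ d′} → s ≋ n ÷ d → u ≋ n′ ÷ d′ → sort (n ++ d′) ≡ sort (n′ ++ d) → s ≈ u
  ≋-unique {s} {u} {n} {d} {n′} {d′} s≋ u≋ sorted = ⊗-cancelˡ (fs d′) (fs-constantTerm d′) (begin
    fs d′ ⊗ s   ≈⟨ *-comm _ _ ⟩
    s ⊗ fs d′   ≈⟨ equation (≋-reduce {n = n} {d} {n′} {d′} s≋ sorted) ⟩
    fs n′       ≈⟨ equation u≋ ⟨
    u ⊗ fs d′   ≈⟨ *-comm _ _ ⟩
    fs d′ ⊗ u   ∎)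

  ≋-^ℕ : ∀ j k → f j ^ℕ k ≋ replicate k j ÷ []
  ≋-^ℕ j zero    = ≋-one
  ≋-^ℕ j (suc k) = ≋-cong (reflexive (≡.sym (^ℕ-suc (f j) k))) (≋-⊗ (≋-f j) (≋-^ℕ j k))

  Π⁻-quotient : ∀ j .{{_ : NonZero j}} → Π⁻ (2 * j) j ≋ j ∷ [] ÷ 2 * j ∷ []
  Π⁻-quotient j = ≋-/ (≋-cong (begin
    f j                                                  ≈⟨ Π⁻-f j ⟨
    Π⁻ j j                                               ≈⟨ progression-split 1-q^-trivial 2 j j ⟩
    Π⁻ (2 * j) (j * 1 + j) ⊗ (Π⁻ (2 * j) (j * 0 + j) ⊗ one)
      ≈⟨ ⊗-cong (trans (reflexive (cong (Π⁻ (2 * j)) lemma)) (Π⁻-f (2 * j) {{ℕ.m*n≢0 2 j}}))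
           (trans (*-identityʳ _) (reflexive (cong (λ x → Π⁻ (2 * j) (x + j)) (ℕ.*-zeroʳ j)))) ⟩
    f (2 * j) ⊗ Π⁻ (2 * j) j                             ≈⟨ *-comm _ _ ⟩
    Π⁻ (2 * j) j ⊗ f (2 * j)                             ∎) (≋-f j)) (≋-f (2 * j))
    where
    lemma : j * 1 + j ≡ 2 * j
    lemma = solve (j ∷ [])

  Π⁺-f : ∀ j .{{_ : NonZero j}} → Π⁺ j j ≋ 2 * j ∷ [] ÷ j ∷ []
  Π⁺-f j = ≋-/ (≋-cong (trans (sym (Π⁻-f (2 * j) {{ℕ.m*n≢0 2 j}}))
      (sym (progression-* 2 1+q^⊗1-q^ j j))) (≋-f (2 * j)))
    (≋-cong (sym (Π⁻-f j)) (≋-f j))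

  Πᵗ-f : ∀ j .{{_ : NonZero j}} → Πᵗ j j ≋ 3 * j ∷ [] ÷ j ∷ []
  Πᵗ-f j = ≋-/ (≋-cong (trans (sym (Π⁻-f (3 * j) {{ℕ.m*n≢0 3 j}}))
      (sym (progression-* 3 1+q^+q^⊗1-q^ j j))) (≋-f (3 * j)))
    (≋-cong (sym (Π⁻-f j)) (≋-f j))

  Π⁺-odd : ∀ j .{{_ : NonZero j}} → Π⁺ (2 * j) j ≋ 2 * j ∷ 2 * j ∷ [] ÷ 2 * (2 * j) ∷ j ∷ []
  Π⁺-odd j = ≋-/ (≋-cong (sym (progression-* 2 1+q^⊗1-q^ (2 * j) j))
      (Π⁻-quotient (2 * j) {{ℕ.m*n≢0 2 j}}))
    (Π⁻-quotient j)

  Πᵗ-odd : ∀ j .{{_ : NonZero j}} → Πᵗ (2 * j) j ≋ 3 * j ∷ 2 * j ∷ [] ÷ 2 * (3 * j) ∷ j ∷ []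
  Πᵗ-odd j = ≋-/ (≋-cong (trans (reflexive (cong (λ x → Π⁻ x (3 * j)) lemma))
      (sym (progression-* 3 1+q^+q^⊗1-q^ (2 * j) j))) (Π⁻-quotient (3 * j) {{ℕ.m*n≢0 3 j}}))
    (Π⁻-quotient j)
    where
    lemma : 2 * (3 * j) ≡ 3 * (2 * j)
    lemma = solve (j ∷ [])

  τ-cong : ∀ {s u} → s ≈ u → τ s ≈ τ u
  τ-cong s≈u = below λ {n} n<L → go n (λ m≤n → coeff s≈u (ℕ.≤-<-trans m≤n n<L))
    where
    go : ∀ n {s u} → (∀ {m} → m ℕ.≤ n → s m ≡ u m) → τ s n ≡ τ u n
    go zero          s≡u = s≡u ℕ.z≤n
    go (suc zero)    s≡u = ≡.refl
    go (suc (suc n)) s≡u = cong ℤ.-_ (go n (λ m≤n → s≡u (ℕ.s≤s (ℕ.m≤n⇒m≤1+n m≤n))))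

  τ-∏ : ∀ K h → τ (∏ K h) ≈ ∏ K (τ ∘ h)
  τ-∏ zero    h = ≗⇒≈ τ-one
  τ-∏ (suc K) h = trans (≗⇒≈ (τ-⊗ (h K) (∏ K h))) (*-congˡ (τ-∏ K h))

  τ-1-q^ : ∀ d → τ (1-q^ d) ≈ one ⊕ ⊖ τ (q^ d)
  τ-1-q^ d = trans (τ-cong (1-q^-def d)) (trans (≗⇒≈ (τ-⊕ one (⊖ q^ d)))
    (+-cong (≗⇒≈ τ-one) (≗⇒≈ (τ-⊖ (q^ d)))))

  τ-1-q^-even : ∀ k → τ (1-q^ (k * 2)) ≈ 1-q^ (k * 4)
  τ-1-q^-even k = trans (τ-1-q^ (k * 2))
    (trans (+-congˡ (-‿cong (≗⇒≈ (τ-q^-even k)))) (sym (1-q^-def (k * 4))))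

  τ-1-q^-odd : ∀ k → τ (1-q^ (1 + k * 2)) ≈ 1+q^ (2 + k * 4)
  τ-1-q^-odd k = trans (τ-1-q^ (1 + k * 2))
    (+-congˡ (trans (-‿cong (≗⇒≈ (τ-q^-odd k))) (-‿involutive _)))

  τ-Π⁻-even : ∀ m k → τ (Π⁻ (m * 2) (k * 2)) ≈ Π⁻ (m * 4) (k * 4)
  τ-Π⁻-even m k = trans (τ-∏ L _) (∏-cong L λ {i} _ →
    trans (reflexive (cong (τ ∘ 1-q^) (lemma i)))
      (trans (τ-1-q^-even (m * i + k)) (reflexive (cong 1-q^ (lemma′ i)))))
    where
    lemma : ∀ i → m * 2 * i + k * 2 ≡ (m * i + k) * 2
    lemma i = solve (m ∷ i ∷ k ∷ [])
    lemma′ : ∀ i → (m * i + k) * 4 ≡ m * 4 * i + k * 4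
    lemma′ i = solve (m ∷ i ∷ k ∷ [])

  τ-Π⁻-odd : ∀ m k → τ (Π⁻ (m * 2) (1 + k * 2)) ≈ Π⁺ (m * 4) (2 + k * 4)
  τ-Π⁻-odd m k = trans (τ-∏ L _) (∏-cong L λ {i} _ →
    trans (reflexive (cong (τ ∘ 1-q^) (lemma i)))
      (trans (τ-1-q^-odd (m * i + k)) (reflexive (cong 1+q^ (lemma′ i)))))
    where
    lemma : ∀ i → m * 2 * i + (1 + k * 2) ≡ 1 + (m * i + k) * 2
    lemma i = solve (m ∷ i ∷ k ∷ [])
    lemma′ : ∀ i → 2 + (m * i + k) * 4 ≡ m * 4 * i + (2 + k * 4)
    lemma′ i = solve (m ∷ i ∷ k ∷ [])

  τ-f-even : ∀ k .{{_ : NonZero (k * 2)}} → τ (f (k * 2)) ≈ f (2 * (k * 2))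
  τ-f-even k = begin
    τ (f (k * 2))                    ≈⟨ τ-cong (Π⁻-f (k * 2)) ⟨
    τ (Π⁻ (k * 2) (k * 2))           ≈⟨ τ-Π⁻-even k k ⟩
    Π⁻ (k * 4) (k * 4)               ≡⟨ cong₂ Π⁻ lemma lemma ⟩
    Π⁻ (2 * (k * 2)) (2 * (k * 2))   ≈⟨ Π⁻-f (2 * (k * 2)) {{ℕ.m*n≢0 2 (k * 2)}} ⟩
    f (2 * (k * 2))                  ∎
    where
    lemma : k * 4 ≡ 2 * (k * 2)
    lemma = solve (k ∷ [])

  -- τ sends 1 - q^m to 1 + q^(2m) for odd m and to 1 - q^(2m) for even m. For odd j the multiples
  -- of j separate into the odd ones, `Π⁻ (2 * j) j`, and the even ones, `f (2 * j)`.
  τ-f-odd : ∀ k → let j = 1 + k * 2 in τ (f j) ≈ Π⁺ (2 * (2 * j)) (2 * j) ⊗ f (2 * (2 * j))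
  τ-f-odd k = begin
    τ (f j)
      ≈⟨ τ-cong (trans (sym (*-identityʳ (f j)))
           (trans (sym (equation (Π⁻-quotient j))) (*-congˡ (*-identityʳ (f (2 * j)))))) ⟩
    τ (Π⁻ (2 * j) j ⊗ f (2 * j))
      ≡⟨ cong (λ x → τ (Π⁻ x j ⊗ f x)) (ℕ.*-comm 2 j) ⟩
    τ (Π⁻ (j * 2) j ⊗ f (j * 2))
      ≈⟨ ≗⇒≈ (τ-⊗ (Π⁻ (j * 2) j) (f (j * 2))) ⟩
    τ (Π⁻ (j * 2) j) ⊗ τ (f (j * 2))
      ≈⟨ ⊗-cong (trans (τ-Π⁻-odd j k) (reflexive (cong₂ Π⁺ lemma lemma′)))
           (trans (τ-f-even j) (reflexive (cong (f ∘ (2 *_)) (ℕ.*-comm j 2)))) ⟩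
    Π⁺ (2 * (2 * j)) (2 * j) ⊗ f (2 * (2 * j))  ∎
    where
    j = 1 + k * 2
    lemma : (1 + k * 2) * 4 ≡ 2 * (2 * (1 + k * 2))
    lemma = solve (k ∷ [])
    lemma′ : 2 + k * 4 ≡ 2 * (1 + k * 2)
    lemma′ = solve (k ∷ [])

  τ-f : ∀ j .{{_ : NonZero j}} → τ (f j) ≋ τ-numerator j ÷ τ-denominator j
  τ-f j with evenOrOdd j
  ... | even k rewrite parity-even k = ≋-cong (sym (τ-f-even k)) (≋-f (2 * (k * 2)))
  ... | odd k  rewrite parity-odd k  = ≋-cong (sym (τ-f-odd k))
    (≋-⊗ (Π⁺-odd (2 * (1 + k * 2))) (≋-f (2 * (2 * (1 + k * 2)))))

  τ-fs : ∀ {js} → All NonZero js → τ (fs js) ≋ concatMap τ-numerator js ÷ concatMap τ-denominator js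
  τ-fs All.[]                       = ≋-cong (sym (≗⇒≈ τ-one)) ≋-one
  τ-fs {j ∷ js} (j≢0 All.∷ js≢0) = ≋-cong (sym (≗⇒≈ (τ-⊗ (f j) (fs js))))
    (≋-⊗ (τ-f j {{j≢0}}) (τ-fs js≢0))

  τ-≋ : ∀ {s n d} → All NonZero n → All NonZero d → s ≋ n ÷ d →
    τ s ≋ concatMap τ-numerator n ++ concatMap τ-denominator d
        ÷ concatMap τ-denominator n ++ concatMap τ-numerator d
  τ-≋ {s} {n} {d} n≢0 d≢0 s≋ = ≋-/
    (≋-cong (trans (τ-cong (sym (equation s≋))) (≗⇒≈ (τ-⊗ s (fs d)))) (τ-fs n≢0)) (τ-fs d≢0)

-- Theta functions and their dissection

module Dissection (L : ℕ) where
  open Products L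
  open TripleProduct L
  open Positivity L
  open Eta L
  open import Relation.Binary.Reasoning.Setoid setoid

  -- Ramanujan's theta function f(q^c, q^d), where c + d = M.
  theta : ℕ → ℕ → ℕ → Series
  theta M c d = f M ⊗ (Π⁺ M d ⊗ Π⁺ M c)

  theta-∑ : ∀ M .{{_ : NonZero M}} c d .{{_ : NonZero c}} .{{_ : NonZero d}} → c + d ≡ M →
    ∀ N → L + L ℕ.≤ N → theta M c d ≈ ∑ (N + N) (λ k → q^ (exponent M c d k N))
  theta-∑ M c d c+d≡M N 2L≤N = trans (*-congˡ (⊗-cong (stable d) (stable c)))
    (triple-product M c d c+d≡M 2L≤N)
    where
    stable : ∀ c → Π⁺ M c ≈ ∏ N (λ i → 1+q^ (M * i + c))
    stable c = sym (∏-stable (λ i → 1+q^ (M * i + c)) (ℕ.≤-trans (ℕ.m≤m+n L L) 2L≤N) (λ {i} L≤i →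
      1+q^-trivial (ℕ.≤-trans L≤i (ℕ.≤-trans (ℕ.m≤n*m i M) (ℕ.m≤m+n (M * i) c)))))

  -- The product form contains `f M`, which has negative coefficients; the triple product rewrites
  -- it as a sum of powers of q.
  theta-nonNeg : ∀ M .{{_ : NonZero M}} c d .{{_ : NonZero c}} .{{_ : NonZero d}} → c + d ≡ M →
    NonNeg (theta M c d)
  theta-nonNeg M c d c+d≡M = nonNeg-≈ (sym (theta-∑ M c d c+d≡M (L + L) ℕ.≤-refl))
    (nonNeg-∑ (L + L + (L + L)) λ k → nonNeg-q^ (exponent M c d k (L + L)))

  -- Splits the series into its terms of even and of odd index.
  theta-dissection : ∀ c e .{{_ : NonZero c}} .{{_ : NonZero e}} → let d = c + e; M = c + d in
    theta M c d ≈ theta (4 * M) (M + 2 * c) (M + 2 * d) ⊕ q^ c ⊗ theta (4 * M) (3 * M + 2 * c) e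
  theta-dissection c@(suc _) e = begin
    theta M c d
      -- With an even centre, the parity of the index k is that of n = k - 2N.
      ≈⟨ theta-∑ M c d ≡.refl (N * 2) (ℕ.≤-trans (ℕ.≤-refl {N}) (ℕ.m≤m*n N 2)) ⟩
    ∑ (N * 2 + N * 2) (λ k → q^ (exponent M c d k (N * 2)))
      ≡⟨ cong (λ K → ∑ K (λ k → q^ (exponent M c d k (N * 2)))) (≡.sym (ℕ.*-distribʳ-+ 2 N N)) ⟩
    ∑ ((N + N) * 2) (λ k → q^ (exponent M c d k (N * 2)))
      ≈⟨ ∑-* (N + N) 2 (λ k → q^ (exponent M c d k (N * 2))) ⟩
    ∑ (N + N) (λ k → q^ (exponent M c d (1 + k * 2) (N * 2))) ⊕
      (∑ (N + N) (λ k → q^ (exponent M c d (k * 2) (N * 2))) ⊕ 𝟘)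
      ≈⟨ +-cong
           (∑-cong (N + N) (λ {k} _ → trans (reflexive (cong q^ (exponent-odd c e k N)))
             (sym (q^-+ ≡.refl))))
           (trans (+-identityʳ _)
             (∑-cong (N + N) (λ {k} _ → reflexive (cong q^ (exponent-even M c d k N))))) ⟩
    ∑ (N + N) (λ k → q^ c ⊗ q^ (exponent (4 * M) (3 * M + 2 * c) e k N)) ⊕
      ∑ (N + N) (λ k → q^ (exponent (4 * M) (M + 2 * c) (M + 2 * d) k N))
      ≈⟨ +-cong
           (trans (∑-⊗ (q^ c) (N + N) _)
             (*-congˡ (sym (theta-∑ (4 * M) (3 * M + 2 * c) e (odd-sum c) N ℕ.≤-refl))))
           (sym (theta-∑ (4 * M) (M + 2 * c) (M + 2 * d) (even-sum c) N ℕ.≤-refl)) ⟩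
    q^ c ⊗ theta (4 * M) (3 * M + 2 * c) e ⊕ theta (4 * M) (M + 2 * c) (M + 2 * d)
      ≈⟨ +-comm _ _ ⟩
    theta (4 * M) (M + 2 * c) (M + 2 * d) ⊕ q^ c ⊗ theta (4 * M) (3 * M + 2 * c) e  ∎
    where
    d = c + e
    M = c + d
    N = L + L
    even-sum : ∀ c → (c + (c + e)) + 2 * c + ((c + (c + e)) + 2 * (c + e)) ≡ 4 * (c + (c + e))
    even-sum c = solve (c ∷ e ∷ [])
    odd-sum : ∀ c → 3 * (c + (c + e)) + 2 * c + e ≡ 4 * (c + (c + e))
    odd-sum c = solve (c ∷ e ∷ [])
    ∑-⊗ : ∀ s K h → ∑ K (λ k → s ⊗ h k) ≈ s ⊗ ∑ K h
    ∑-⊗ s zero    h = sym (zeroʳ s)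
    ∑-⊗ s (suc K) h = trans (+-congˡ (∑-⊗ s K h)) (sym (distribˡ s (h K) (∑ K h)))

  theta-constantTerm : ∀ M c d .{{_ : NonZero c}} .{{_ : NonZero d}} → theta M c d 0 ≡ 1ℤ
  theta-constantTerm M c d = ⊗-constantTerm {f M} ≡.refl
    (⊗-constantTerm (progression-constantTerm {1+q^} 1+q^-constantTerm M d)
      (progression-constantTerm {1+q^} 1+q^-constantTerm M c))

  Positive⇒NonNeg : ∀ {s} → Positive s → NonNeg s
  Positive⇒NonNeg 0<s n<L = ℤ.<⇒≤ (0<s n<L)

  record Admissible (s : Series) : Set where
    constructor admissible
    field
      nonNeg       : NonNeg s
      constantTerm : s 0 ≡ 1ℤ
  open Admissible

  pos₀ : ∀ {s} → Admissible s → 0ℤ ℤ.< s 0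
  pos₀ s≥ = ≡.subst (0ℤ ℤ.<_) (≡.sym (constantTerm s≥)) (ℤ.+<+ (ℕ.s≤s ℕ.z≤n))

  -- The summand `s 0` times `u n` is positive and all others are nonnegative.
  ⊗-positive : ∀ {s u} → Admissible s → Positive u → Positive (s ⊗ u)
  ⊗-positive s≥ 0<u {n} n<L = ⊗-pos (nonNeg s≥) (Positive⇒NonNeg 0<u) 0 n n<L (pos₀ s≥) (0<u n<L)

  progression-admissible : ∀ {h} → (∀ d → NonNeg (h d)) → (∀ d .{{_ : NonZero d}} → h d 0 ≡ 1ℤ) →
    ∀ M c .{{_ : NonZero c}} → Admissible (progression h M c)
  progression-admissible {h} 0≤h h₀ M c = admissible (nonNeg-∏ L λ i → 0≤h (M * i + c))
    (progression-constantTerm {h} h₀ M c)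

  nonNeg-1+q^ : ∀ d → NonNeg (1+q^ d)
  nonNeg-1+q^ d = nonNeg-⊕ (nonNeg-q^ 0) (nonNeg-q^ d)

  Π⁺-admissible : ∀ M c .{{_ : NonZero c}} → Admissible (Π⁺ M c)
  Π⁺-admissible = progression-admissible {1+q^} nonNeg-1+q^ 1+q^-constantTerm

  Πᵗ-admissible : ∀ M c .{{_ : NonZero c}} → Admissible (Πᵗ M c)
  Πᵗ-admissible = progression-admissible {1+q^+q^}
    (λ d → nonNeg-⊕ (nonNeg-q^ 0) (nonNeg-⊕ (nonNeg-q^ d) (nonNeg-q^ (2 * d)))) 1+q^+q^-constantTerm

  inverse-Π⁻-admissible : ∀ M c .{{_ : NonZero c}} → Admissible (inverse (Π⁻ M c))
  inverse-Π⁻-admissible M c = admissible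
    (nonNeg-cancel-∏ L (λ i → M * i + c) (λ i → +-nonZeroʳ (M * i) c)
      (nonNeg-≈ (sym (⊗-inverseʳ (Π⁻ M c)
        (progression-constantTerm {1-q^} 1-q^-constantTerm M c))) (nonNeg-q^ 0)))
    ≡.refl

  -- The coefficients count partitions into distinct parts, and n + 1 has the partition with a
  -- single part.
  Π⁺-positive : Positive (Π⁺ 1 1)
  Π⁺-positive {zero}  n<L = pos₀ (Π⁺-admissible 1 1)
  Π⁺-positive {suc n} n<L = ≡.subst (λ m → 0ℤ ℤ.< Π⁺ 1 1 m) (lemma n)
    (∏-1+q^-pos L (λ i → 1 * i + 1) (λ i → +-nonZeroʳ (1 * i) 1) (ℕ.<-trans (ℕ.n<1+n n) n<L)
      (≡.subst (ℕ._< L) (≡.sym (lemma n)) n<L))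
    where
    lemma : ∀ n → 1 * n + 1 ≡ suc n
    lemma n = solve (n ∷ [])

  Π⁺-odd-pos : ∀ k → 1 + k * 2 ℕ.< L → 0ℤ ℤ.< Π⁺ 2 1 (1 + k * 2)
  Π⁺-odd-pos k <L = ≡.subst (λ m → 0ℤ ℤ.< Π⁺ 2 1 m) (lemma k)
    (∏-1+q^-pos L (λ i → 2 * i + 1) (λ i → +-nonZeroʳ (2 * i) 1)
      (ℕ.≤-<-trans (ℕ.≤-trans (ℕ.m≤m*n k 2) (ℕ.n≤1+n (k * 2))) <L)
      (≡.subst (ℕ._< L) (≡.sym (lemma k)) <L))
    where
    lemma : ∀ k → 2 * k + 1 ≡ 1 + k * 2
    lemma k = solve (k ∷ [])

  -- Every n > 0 is odd or 1 plus an odd number.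
  ⊗-Π⁺-positive : ∀ {s} → Admissible s → (1 ℕ.< L → 0ℤ ℤ.< s 1) → Positive (s ⊗ Π⁺ 2 1)
  ⊗-Π⁺-positive {s} s≥ 0<s₁ {n} n<L with evenOrOdd n
  ... | odd k        = ⊗-pos (nonNeg s≥) (nonNeg (Π⁺-admissible 2 1)) 0 (1 + k * 2) n<L
    (pos₀ s≥) (Π⁺-odd-pos k n<L)
  ... | even zero    = ⊗-pos (nonNeg s≥) (nonNeg (Π⁺-admissible 2 1)) 0 0 n<L
    (pos₀ s≥) (pos₀ (Π⁺-admissible 2 1))
  ... | even (suc k) = ⊗-pos (nonNeg s≥) (nonNeg (Π⁺-admissible 2 1)) 1 (1 + k * 2) n<L
    (0<s₁ (ℕ.≤-<-trans (ℕ.s≤s ℕ.z≤n) n<L)) (Π⁺-odd-pos k (ℕ.<-trans (ℕ.n<1+n _) n<L))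

  split₂ : ∀ M .{{_ : NonZero M}} c → Π⁺ M c ≈ Π⁺ (2 * M) (M * 1 + c) ⊗ Π⁺ (2 * M) (M * 0 + c)
  split₂ M c = trans (progression-split 1+q^-trivial 2 M c) (*-congˡ (*-identityʳ _))

  split₃ : ∀ M .{{_ : NonZero M}} c →
    Π⁺ M c ≈ Π⁺ (3 * M) (M * 2 + c) ⊗ (Π⁺ (3 * M) (M * 1 + c) ⊗ Π⁺ (3 * M) (M * 0 + c))
  split₃ M c = trans (progression-split 1+q^-trivial 3 M c) (*-congˡ (*-congˡ (*-identityʳ _)))

  split₄ : ∀ M .{{_ : NonZero M}} c → Π⁺ M c ≈
    Π⁺ (4 * M) (M * 3 + c) ⊗ (Π⁺ (4 * M) (M * 2 + c) ⊗
      (Π⁺ (4 * M) (M * 1 + c) ⊗ Π⁺ (4 * M) (M * 0 + c)))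
  split₄ M c = trans (progression-split 1+q^-trivial 4 M c)
    (*-congˡ (*-congˡ (*-congˡ (*-identityʳ _))))

  theta-4-1-3 : theta 4 1 3 ≋ 2 ∷ 2 ∷ [] ÷ 1 ∷ []
  theta-4-1-3 = ≋-reduce (≋-⊗ (≋-f 4) (≋-cong (split₂ 2 1) (Π⁺-odd 1))) ≡.refl

  theta-12-3-9 : theta 12 3 9 ≋ 6 ∷ 6 ∷ [] ÷ 3 ∷ []
  theta-12-3-9 = ≋-reduce (≋-⊗ (≋-f 12) (≋-cong (split₂ 6 3) (Π⁺-odd 3))) ≡.refl

  -- The product `Π⁺ 2 1` splits into the residues 1, 3, 5 modulo 6; dividing by `Π⁺ 6 3` leaves the
  -- two factors of the theta function. The next two lemmas remove one of three residues modulo 24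
  -- in the same way.
  theta-6-1-5 : theta 6 1 5 ≋ 2 ∷ 2 ∷ 3 ∷ 12 ∷ [] ÷ 1 ∷ 4 ∷ 6 ∷ []
  theta-6-1-5 = ≋-reduce (≋-⊗ (≋-f 6) (≋-/ (≋-cong (trans (split₃ 2 1)
    (solve-⊗ 3 (λ x y z → x ⊙ (y ⊙ z) ⊜ (x ⊙ z) ⊙ y) refl _ _ _)) (Π⁺-odd 1)) (Π⁺-odd 3))) ≡.refl

  theta-24-8-16 : theta 24 8 16 ≋ 16 ∷ 24 ∷ 24 ∷ [] ÷ 8 ∷ 48 ∷ []
  theta-24-8-16 = ≋-reduce (≋-⊗ (≋-f 24)
    (≋-/ (≋-cong (trans (split₃ 8 8) (*-comm _ _)) (Π⁺-f 8)) (Π⁺-f 24))) ≡.refl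

  theta-24-20-4 : theta 24 20 4 ≋ 8 ∷ 8 ∷ 12 ∷ 48 ∷ [] ÷ 4 ∷ 16 ∷ 24 ∷ []
  theta-24-20-4 = ≋-reduce (≋-⊗ (≋-f 24) (≋-/ (≋-cong (trans (split₃ 8 4)
    (solve-⊗ 3 (λ x y z → x ⊙ (y ⊙ z) ⊜ (z ⊙ x) ⊙ y) refl _ _ _)) (Π⁺-odd 4)) (Π⁺-odd 12))) ≡.refl

-- The three eta quotients

numerator denominator : ℕ → ℤ → List ℕ
numerator j (ℤ.+ k)      = replicate k j
numerator j ℤ.-[1+ k ]   = []
denominator j (ℤ.+ k)    = []
denominator j ℤ.-[1+ k ] = replicate (suc k) j

module Cases (L : ℕ) where
  open Products L
  open TripleProduct L
  open Positivity L
  open Eta L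
  open Dissection L
  open Admissible
  open import Relation.Binary.Reasoning.Setoid setoid

  τ-≋′ : ∀ {s n d} {n≢0 : True (All.all? ℕ.nonZero? n)} {d≢0 : True (All.all? ℕ.nonZero? d)} →
    s ≋ n ÷ d →
    τ s ≋ concatMap τ-numerator n ++ concatMap τ-denominator d
        ÷ concatMap τ-denominator n ++ concatMap τ-numerator d
  τ-≋′ {n≢0 = n≢0} {d≢0} = τ-≋ (toWitness n≢0) (toWitness d≢0)

  ≋-^ℤ : ∀ j z → f j ^ℤ z ≋ numerator j z ÷ denominator j z
  ≋-^ℤ j (ℤ.+ k)    = ≋-^ℕ j k
  ≋-^ℤ j ℤ.-[1+ k ] = ≋-inverse (^ℕ-constantTerm (f j) (suc k) ≡.refl) (≋-^ℕ j (suc k))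

  a-≋ : ∀ t₁ t₂ t₃ t₄ → a (t₁ Vec.∷ t₂ Vec.∷ t₃ Vec.∷ t₄ Vec.∷ Vec.[]) ≋
    numerator 1 t₁ ++ numerator 2 t₂ ++ numerator 3 t₃ ++ numerator 4 t₄ ++ [] ÷
    denominator 1 t₁ ++ denominator 2 t₂ ++ denominator 3 t₃ ++ denominator 4 t₄ ++ []
  a-≋ t₁ t₂ t₃ t₄ = ≋-cong (sym (reflexive (a-⊗ t₁ t₂ t₃ t₄)))
    (≋-⊗ (≋-^ℤ 1 t₁) (≋-⊗ (≋-^ℤ 2 t₂) (≋-⊗ (≋-^ℤ 3 t₃) (≋-⊗ (≋-^ℤ 4 t₄) ≋-one))))

  record Alternating (s : Series) : Set where
    constructor alternating
    field
      {E O}       : Series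
      E-positive  : Positive E
      O-positive  : Positive O
      dissection  : s ≈ τ E ⊕ q^ 1 ⊗ τ O

  alternate : ∀ {s θ θᵉ θᵒ E O} → θ 0 ≡ 1ℤ → θ ≈ θᵉ ⊕ q^ 1 ⊗ θᵒ →
    s ⊗ inverse θ ⊗ θᵉ ≈ τ E → s ⊗ inverse θ ⊗ θᵒ ≈ τ O →
    Positive E → Positive O → Alternating s
  alternate {s} {θ} {θᵉ} {θᵒ} {E} {O} θ₀ θ≈ Cθᵉ≈ Cθᵒ≈ E>0 O>0 = alternating E>0 O>0 (begin
    s                                                     ≈⟨ *-identityʳ s ⟨
    s ⊗ one
      ≈⟨ *-congˡ (trans (*-comm _ _) (⊗-inverseʳ θ θ₀)) ⟨
    s ⊗ (inverse θ ⊗ θ)                                   ≈⟨ *-assoc _ _ _ ⟨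
    s ⊗ inverse θ ⊗ θ                                     ≈⟨ *-congˡ θ≈ ⟩
    s ⊗ inverse θ ⊗ (θᵉ ⊕ q^ 1 ⊗ θᵒ)                      ≈⟨ distribˡ _ _ _ ⟩
    s ⊗ inverse θ ⊗ θᵉ ⊕ s ⊗ inverse θ ⊗ (q^ 1 ⊗ θᵒ)
      ≈⟨ +-congˡ (solve-⊗ 3 (λ c q θ → c ⊙ (q ⊙ θ) ⊜ q ⊙ (c ⊙ θ)) refl _ _ _) ⟩
    s ⊗ inverse θ ⊗ θᵉ ⊕ q^ 1 ⊗ (s ⊗ inverse θ ⊗ θᵒ)      ≈⟨ +-cong Cθᵉ≈ (*-congˡ Cθᵒ≈) ⟩
    τ E ⊕ q^ 1 ⊗ τ O                                      ∎)

  alternating₁ : Alternating (a (ℤ.-[1+ 0 ] Vec.∷ ℤ.+ 3 Vec.∷ ℤ.+ 1 Vec.∷ ℤ.-[1+ 2 ] Vec.∷ Vec.[]))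
  alternating₁ = alternate (theta-constantTerm 6 1 5) (theta-dissection 1 4)
    -- Here C = f₂ f₆ / (f₄² f₁₂). Replacing q² by -q in C f(q⁸, q¹⁶) gives E = f₂ f₆² f₈ f₁₂ / (f₁
    -- f₃ f₄² f₂₄), grouped as f₆²/(f₃ f₁₂) · f₈ f₁₂/(f₄ f₂₄) · f₁₂/f₄ · f₂/f₁. Likewise O = f₄ f₆³
    -- f₂₄ / (f₁ f₃ f₈ f₁₂²).
    (≋-unique (≋-⊗ C≋ theta-24-8-16)
      (τ-≋′ (≋-⊗ (Π⁺-odd 3) (≋-⊗ (Πᵗ-odd 4) (≋-⊗ (Πᵗ-f 4) (Π⁺-f 1))))) ≡.refl)
    (≋-unique (≋-⊗ C≋ theta-24-20-4)
      (τ-≋′ (≋-⊗ (Πᵗ-odd 2) (≋-⊗ (Π⁺-odd 3) (≋-⊗ (Πᵗ-f 8) (Π⁺-f 1))))) ≡.refl)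
    (⊗-positive (Π⁺-admissible 6 3) (⊗-positive (Πᵗ-admissible 8 4)
      (⊗-positive (Πᵗ-admissible 4 4) Π⁺-positive)))
    (⊗-positive (Πᵗ-admissible 4 2) (⊗-positive (Π⁺-admissible 6 3)
      (⊗-positive (Πᵗ-admissible 8 8) Π⁺-positive)))
    where
    C≋ = ≋-⊗ (a-≋ (ℤ.-[1+ 0 ]) (ℤ.+ 3) (ℤ.+ 1) (ℤ.-[1+ 2 ]))
      (≋-inverse (theta-constantTerm 6 1 5) theta-6-1-5)

  -- The truncated product depends on the variable L and does not evaluate; the equal eta quotient
  -- f₂²/f₁ is independent of L, and its coefficient computes.
  theta-4-1-3-coefficient : 1 ℕ.< L → theta 4 1 3 1 ≡ 1ℤ
  theta-4-1-3-coefficient 1<L = ≡.trans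
    (coeff (≋-unique theta-4-1-3 (≋-⊗ (≋-f 2) (≋-⊗ (≋-f 2) (≋-inverse ≡.refl (≋-f 1)))) ≡.refl) 1<L)
    f₂²/f₁-coefficient

  alternating₂ : Alternating (a (ℤ.-[1+ 0 ] Vec.∷ ℤ.+ 4 Vec.∷ ℤ.+ 1 Vec.∷ ℤ.-[1+ 2 ] Vec.∷ Vec.[]))
  alternating₂ = alternate (theta-constantTerm 6 1 5) (theta-dissection 1 4)
    -- The additional f₂ of this quotient becomes f₂³/(f₁ f₄) under q² ↦ -q and multiplies the
    -- previous E and O. Regrouped, E contains the theta function f₆²/f₃ and the square of f₂²/(f₁
    -- f₄) = ∏ (1 + q^(2k-1)).
    (≋-unique (≋-⊗ C≋ theta-24-8-16)
      (τ-≋′ (≋-⊗ theta-12-3-9 (≋-⊗ (Πᵗ-odd 4) (≋-⊗ (Π⁺-odd 1) (Π⁺-odd 1))))) ≡.refl)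
    (≋-unique (≋-⊗ C≋ theta-24-20-4)
      (τ-≋′ (≋-⊗ (Πᵗ-odd 2) (≋-⊗ (Π⁺-odd 3) (≋-⊗ (Πᵗ-f 8) (≋-⊗ theta-4-1-3 (Π⁺-odd 1)))))) ≡.refl)
    (⊗-positive (admissible (theta-nonNeg 12 3 9 ≡.refl) (theta-constantTerm 12 3 9))
      (⊗-positive (Πᵗ-admissible 8 4) (⊗-Π⁺-positive (Π⁺-admissible 2 1) (Π⁺-odd-pos 0))))
    (⊗-positive (Πᵗ-admissible 4 2) (⊗-positive (Π⁺-admissible 6 3) (⊗-positive (Πᵗ-admissible 8 8)
      (⊗-Π⁺-positive (admissible (theta-nonNeg 4 1 3 ≡.refl) (theta-constantTerm 4 1 3))
        (λ 1<L → ≡.subst (0ℤ ℤ.<_) (≡.sym (theta-4-1-3-coefficient 1<L)) (ℤ.+<+ (ℕ.s≤s ℕ.z≤n)))))))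
    where
    C≋ = ≋-⊗ (a-≋ (ℤ.-[1+ 0 ]) (ℤ.+ 4) (ℤ.+ 1) (ℤ.-[1+ 2 ]))
      (≋-inverse (theta-constantTerm 6 1 5) theta-6-1-5)

  alternating₃ : Alternating (a (ℤ.-[1+ 0 ] Vec.∷ ℤ.+ 4 Vec.∷ ℤ.+ 0 Vec.∷ ℤ.-[1+ 3 ] Vec.∷ Vec.[]))
  alternating₃ = alternate (theta-constantTerm 4 1 3) (theta-dissection 1 2)
    (component 1 7 (τ-Π⁻-odd 4 0) (τ-Π⁻-odd 4 3) (begin
      Π⁺ 16 2 ⊗ Π⁺ 16 14 ⊗ (Π⁺ 16 10 ⊗ Π⁺ 16 6)
        ≈⟨ solve-⊗ 4 (λ w x y z → (w ⊙ z) ⊙ (y ⊙ x) ⊜ z ⊙ (y ⊙ (x ⊙ w))) refl _ _ _ _ ⟩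
      Π⁺ 16 14 ⊗ (Π⁺ 16 10 ⊗ (Π⁺ 16 6 ⊗ Π⁺ 16 2))
        ≈⟨ split₄ 4 2 ⟨
      Π⁺ 4 2  ∎))
    (component 3 5 (τ-Π⁻-odd 4 1) (τ-Π⁻-odd 4 2) (begin
      Π⁺ 16 6 ⊗ Π⁺ 16 10 ⊗ (Π⁺ 16 2 ⊗ Π⁺ 16 14)
        ≈⟨ solve-⊗ 4 (λ w x y z → (x ⊙ y) ⊙ (w ⊙ z) ⊜ z ⊙ (y ⊙ (x ⊙ w))) refl _ _ _ _ ⟩
      Π⁺ 16 14 ⊗ (Π⁺ 16 10 ⊗ (Π⁺ 16 6 ⊗ Π⁺ 16 2))
        ≈⟨ split₄ 4 2 ⟨
      Π⁺ 4 2  ∎))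
    (G-positive 1 7) (G-positive 3 5)
    where
    C = a (ℤ.-[1+ 0 ] Vec.∷ ℤ.+ 4 Vec.∷ ℤ.+ 0 Vec.∷ ℤ.-[1+ 3 ] Vec.∷ Vec.[]) ⊗ inverse (theta 4 1 3)

    C≋ = ≋-⊗ (a-≋ (ℤ.-[1+ 0 ]) (ℤ.+ 4) (ℤ.+ 0) (ℤ.-[1+ 3 ]))
      (≋-inverse (theta-constantTerm 4 1 3) theta-4-1-3)

    -- The two parts of the dissection are not eta quotients, but their product is, so each
    -- of them can be traded for the reciprocal of the other.
    G : ℕ → ℕ → Series
    G c c′ = inverse (Π⁻ 8 c) ⊗ (inverse (Π⁻ 8 c′) ⊗ (inverse (f 4) ⊗ (Π⁺ 4 4 ⊗ Π⁺ 1 1)))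

    G-positive : ∀ c c′ .{{_ : NonZero c}} .{{_ : NonZero c′}} → Positive (G c c′)
    G-positive c c′ = ⊗-positive (inverse-Π⁻-admissible 8 c)
      (⊗-positive (inverse-Π⁻-admissible 8 c′)
      (⊗-positive
        (admissible (nonNeg-≈ (⊗-inverse-cong
            (progression-constantTerm {1-q^} 1-q^-constantTerm 4 4) ≡.refl (Π⁻-f 4))
          (nonNeg (inverse-Π⁻-admissible 4 4))) ≡.refl)
        (⊗-positive (Π⁺-admissible 4 4) Π⁺-positive)))

    -- Multiplication by `τ (p ⊗ p′)` supplies the residue classes missing from `Π⁺ 4 2` on the left
    -- and cancels the two reciprocals in `G c c′` on the right. Both sides are then eta quotients.
    component : ∀ c c′ {x x′ y z} .{{_ : NonZero c}} .{{_ : NonZero c′}} →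
      τ (Π⁻ 8 c) ≈ x → τ (Π⁻ 8 c′) ≈ x′ → x ⊗ x′ ⊗ (y ⊗ z) ≈ Π⁺ 4 2 →
      C ⊗ (f 16 ⊗ (y ⊗ z)) ≈ τ (G c c′)
    component c c′ {x} {x′} {y} {z} τp≈x τp′≈x′ all =
      ⊗-cancelˡ (τ (p ⊗ p′)) (⊗-constantTerm p₀ p′₀) (begin
      τ (p ⊗ p′) ⊗ (C ⊗ (f 16 ⊗ (y ⊗ z)))
        ≈⟨ *-congʳ (trans (≗⇒≈ (τ-⊗ p p′)) (⊗-cong τp≈x τp′≈x′)) ⟩
      x ⊗ x′ ⊗ (C ⊗ (f 16 ⊗ (y ⊗ z)))
        ≈⟨ solve-⊗ 4 (λ X C F Y → X ⊙ (C ⊙ (F ⊙ Y)) ⊜ C ⊙ (F ⊙ (X ⊙ Y)))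
             refl (x ⊗ x′) C (f 16) (y ⊗ z) ⟩
      C ⊗ (f 16 ⊗ (x ⊗ x′ ⊗ (y ⊗ z)))
        ≈⟨ *-congˡ (*-congˡ all) ⟩
      C ⊗ (f 16 ⊗ Π⁺ 4 2)
        ≈⟨ ≋-unique (≋-⊗ C≋ (≋-⊗ (≋-f 16) (Π⁺-odd 2))) (τ-≋′ G≋) ≡.refl ⟩
      τ (p ⊗ p′ ⊗ G c c′)
        ≈⟨ ≗⇒≈ (τ-⊗ (p ⊗ p′) (G c c′)) ⟩
      τ (p ⊗ p′) ⊗ τ (G c c′)  ∎)
      where
      p = Π⁻ 8 c
      p′ = Π⁻ 8 c′
      p₀ : p 0 ≡ 1ℤ
      p₀ = progression-constantTerm {1-q^} 1-q^-constantTerm 8 c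
      p′₀ : p′ 0 ≡ 1ℤ
      p′₀ = progression-constantTerm {1-q^} 1-q^-constantTerm 8 c′
      r = inverse (f 4) ⊗ (Π⁺ 4 4 ⊗ Π⁺ 1 1)
      G≋ = ≋-cong (begin
        r
          ≈⟨ *-identityˡ r ⟨
        one ⊗ r
          ≈⟨ *-congʳ (trans (⊗-cong (⊗-inverseʳ p p₀) (⊗-inverseʳ p′ p′₀)) (*-identityˡ one)) ⟨
        p ⊗ inverse p ⊗ (p′ ⊗ inverse p′) ⊗ r
          ≈⟨ solve-⊗ 5 (λ p i p′ i′ r → ((p ⊙ i) ⊙ (p′ ⊙ i′)) ⊙ r ⊜ (p ⊙ p′) ⊙ (i ⊙ (i′ ⊙ r)))
               refl p (inverse p) p′ (inverse p′) r ⟩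
        p ⊗ p′ ⊗ G c c′  ∎)
        (≋-⊗ (≋-inverse ≡.refl (≋-f 4)) (≋-⊗ (Π⁺-f 4) (Π⁺-f 1)))

  alternating-S₅ : ∀ {t} → t ∈ S₅ → Alternating (a t)
  alternating-S₅ (here ≡.refl)                 = alternating₁
  alternating-S₅ (there (here ≡.refl))         = alternating₂
  alternating-S₅ (there (there (here ≡.refl))) = alternating₃

theorem4p2 : (t : Vec ℤ 4) → t ∈ S₅ → (n : ℕ) →
    (a t (4 * n) > 0ℤ) × (a t (4 * n + 1) > 0ℤ) ×
    (a t (4 * n + 2) < 0ℤ) × (a t (4 * n + 3) < 0ℤ)
-- The modulus `4 * n + 4` lies just above the largest degree needed, 4n + 3, and above 2n + 1, the
-- largest degree at which E and O are evaluated.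
theorem4p2 t t∈S₅ n with Cases.alternating-S₅ (4 * n + 4) t∈S₅
... | Cases.alternating {E} {O} E>0 O>0 a≈ with τ-mod-4 E O n
... | e₀ , e₁ , e₂ , e₃ =
    positive (ℕ.m<m+n (4 * n) (ℕ.s≤s ℕ.z≤n)) e₀ (E>0 2n<L)
  , positive (ℕ.+-monoʳ-< (4 * n) (ℕ.≤ᵇ⇒≤ 2 4 _)) e₁ (O>0 2n<L)
  , negative (ℕ.+-monoʳ-< (4 * n) (ℕ.≤ᵇ⇒≤ 3 4 _)) e₂ (E>0 2n+1<L)
  , negative (ℕ.+-monoʳ-< (4 * n) (ℕ.≤ᵇ⇒≤ 4 4 _)) e₃ (O>0 2n+1<L)
  where
  open Modulo (4 * n + 4) using (coeff)
  v = τ E ⊕ q^ 1 ⊗ τ O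
  positive : ∀ {m i} → m ℕ.< 4 * n + 4 → v m ≡ i → 0ℤ < i → a t m > 0ℤ
  positive m<L v≡i = ≡.subst (0ℤ <_) (≡.sym (≡.trans (coeff a≈ m<L) v≡i))
  negative : ∀ {m i} → m ℕ.< 4 * n + 4 → v m ≡ ℤ.- i → 0ℤ < i → a t m < 0ℤ
  negative m<L v≡-i 0<i =
    ≡.subst (_< 0ℤ) (≡.sym (≡.trans (coeff a≈ m<L) v≡-i)) (ℤ.neg-mono-< 0<i)
  2n<L : 2 * n ℕ.< 4 * n + 4
  2n<L = ℕ.≤-<-trans (ℕ.*-monoˡ-≤ n (ℕ.≤ᵇ⇒≤ 2 4 _)) (ℕ.m<m+n (4 * n) (ℕ.s≤s ℕ.z≤n))
  2n+1<L : 2 * n + 1 ℕ.< 4 * n + 4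
  2n+1<L = ℕ.+-mono-≤-< (ℕ.*-monoˡ-≤ n (ℕ.≤ᵇ⇒≤ 2 4 _)) (ℕ.≤ᵇ⇒≤ 2 4 _)
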